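{- Let $q$ be a prime power, $m,l,k$ integers with $3\le k\le\min\{m+1,l\}$, and $1\le r\le k-1$. Let $\langle 1,u_1,\dots,u_r\rangle$ be an $(r+1)$-dimensional $\mathrm{GF}(q)$-subspace of $\mathrm{GF}(q^l)$. Then the size of the stabilizer of $T(u_1,\dots,u_r)$ in $G$ is $$\bigl|G_{T(u_1,\dots,u_r)}\bigr|=\bigl|H_{\langle 1,u_1,\dots,u_r\rangle}\bigr|\prod_{i=r+1}^{k-1}(q^k-q^i)\prod_{i=k-1}^{m-1}(q^{ml}-q^{il}).$$
   Context: Empty products equal $1$. $V$ is an $m$-dimensional vector space over $\mathrm{GF}(q^l)$ with basis $Y_1,\dots,Y_m$, regarded also as an $ml$-dimensional space over $\mathrm{GF}(q)$. $G=\mathrm{GL}(m,q^l)$ acts $\mathrm{GF}(q^l)$-linearly on $V$ and hence on its $\mathrm{GF}(q)$-subspaces; $G_W=\{g\in G:g(W)=W\}$. $H$ is a Singer cycle of $\mathrm{GF}(q^l)$, i.e. the group of multiplications by elements of $\mathrm{GF}(q^l)^*$, acting on the $\mathrm{GF}(q)$-subspaces of $\mathrm{GF}(q^l)$; $H_W$ is the stabilizer of $W$ in $H$. $\langle\cdot\rangle$ denotes $\mathrm{GF}(q)$-span. For $u_1,\dots,u_r\in\mathrm{GF}(q^l)$ with $1,u_1,\dots,u_r$ linearly independent over $\mathrm{GF}(q)$, $$T(u_1,\dots,u_r)=\langle Y_1,\dots,Y_{k-1},\,u_1Y_1+\cdots+u_rY_r\rangle,$$ a $k$-dimensional $\mathrm{GF}(q)$-subspace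 of $V$. -}

module Defs where

open import Level using (Level; _⊔_; suc)
open import Algebra.Bundles using (CommutativeRing; Ring)
open import Algebra.Module.Bundles using (LeftModule)
open import Algebra.Module.Construct.TensorUnit using (leftModule)
open import Algebra.Module.Morphism.Structures using (IsLeftModuleIsomorphism)
open import Algebra.Morphism.Structures using (IsRingHomomorphism)
import Algebra.Properties.Monoid.Sum as MonoidSum
open import Data.Fin.Base using (Fin; inject≤)
open import Data.List.Base using (map; upTo)
open import Data.Nat.Base as ℕ using (ℕ; _∸_; _≤_; _^_)
open import Data.Nat.ListAction using (product)
open import Data.Nat.Primality using (Prime)
open import Data.Nat.Properties using (m≤n+o⇒m∸n≤o; ≤-trans)
open import Data.Product.Base using (∃; ∃₂; _×_; _,_; proj₁)
open import Data.Vec.Functional using (Vector; _∷_; []; _++_)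
open import Function.Bundles using (Inverse)
open import Relation.Binary.Bundles using (Setoid)
open import Relation.Binary.PropositionalEquality as ≡ using (_≡_)
open import Relation.Nullary using (¬_)
open import Relation.Unary using (Pred; _∈_; _≐_)

private
  variable
    a b c p ℓ ℓ₁ ℓ₂ : Level

IsPrimePower : ℕ → Set
IsPrimePower q = ∃₂ λ p e → Prime p × 1 ≤ e × q ≡ p ^ e

-- The product of f i over i₀ ≤ i < i₁, which is 1 when i₁ ≤ i₀.
∏[_≤i<_] : ℕ → ℕ → (ℕ → ℕ) → ℕ
∏[ i₀ ≤i< i₁ ] f = product (map (λ j → f (i₀ ℕ.+ j)) (upTo (i₁ ∸ i₀)))

HasSize : Setoid c ℓ → ℕ → Set (c ⊔ ℓ)
HasSize S n = Inverse S (≡.setoid (Fin n))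

record Field c ℓ : Set (suc (c ⊔ ℓ)) where
  field
    commutativeRing : CommutativeRing c ℓ
  open CommutativeRing commutativeRing public
  field
    1≉0     : ¬ (1# ≈ 0#)
    inverse : ∀ x → ¬ (x ≈ 0#) → ∃ λ y → x * y ≈ 1#

module _ {R : Ring a ℓ₁} (M : LeftModule R b ℓ₂) where
  private module R = Ring R
  open LeftModule M

  linearCombination : ∀ {n} → Vector R.Carrier n → Vector Carrierᴹ n → Carrierᴹ
  linearCombination α v = MonoidSum.sum +ᴹ-monoid (λ i → α i *ₗ v i)

  Span : ∀ {n} → Vector Carrierᴹ n → Pred Carrierᴹ (a ⊔ ℓ₂)
  Span v x = ∃ λ α → x ≈ᴹ linearCombination α v

  LinearlyIndependent : ∀ {n} → Vector Carrierᴹ n → Set (a ⊔ ℓ₁ ⊔ ℓ₂)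
  LinearlyIndependent v =
    ∀ α → linearCombination α v ≈ᴹ 0ᴹ → ∀ i → α i R.≈ R.0#

  IsBasis : ∀ {n} → Vector Carrierᴹ n → Set (a ⊔ b ⊔ ℓ₁ ⊔ ℓ₂)
  IsBasis v = LinearlyIndependent v × (∀ x → x ∈ Span v)

  HasDimension : Pred Carrierᴹ p → ℕ → Set (a ⊔ b ⊔ p ⊔ ℓ₁ ⊔ ℓ₂)
  HasDimension W n =
    ∃ λ (v : Vector Carrierᴹ n) → LinearlyIndependent v × W ≐ Span v

module _ {F : Ring c ℓ} {K : Ring a ℓ₁}
         {ι : Ring.Carrier F → Ring.Carrier K}
         (ι-homo : IsRingHomomorphism (Ring.rawRing F) (Ring.rawRing K) ι)
         where
  open IsRingHomomorphism ι-homo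

  restrictScalars : LeftModule K b ℓ₂ → LeftModule F b ℓ₂
  restrictScalars M = record
    { Carrierᴹ     = Carrierᴹ
    ; _≈ᴹ_         = _≈ᴹ_
    ; _+ᴹ_         = _+ᴹ_
    ; _*ₗ_         = λ x v → ι x *ₗ v
    ; 0ᴹ           = 0ᴹ
    ; -ᴹ_          = -ᴹ_
    ; isLeftModule = record
      { isLeftSemimodule = record
        { +ᴹ-isCommutativeMonoid = +ᴹ-isCommutativeMonoid
        ; isPreleftSemimodule    = record
          { *ₗ-cong      = λ x≈y → *ₗ-cong (⟦⟧-cong x≈y)
          ; *ₗ-zeroˡ     = λ v → ≈ᴹ-trans (*ₗ-congʳ 0#-homo) (*ₗ-zeroˡ v)
          ; *ₗ-distribʳ  = λ v x y →
              ≈ᴹ-trans (*ₗ-congʳ (+-homo x y)) (*ₗ-distribʳ v (ι x) (ι y))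
          ; *ₗ-identityˡ = λ v → ≈ᴹ-trans (*ₗ-congʳ 1#-homo) (*ₗ-identityˡ v)
          ; *ₗ-assoc     = λ x y v →
              ≈ᴹ-trans (*ₗ-congʳ (*-homo x y)) (*ₗ-assoc (ι x) (ι y) v)
          ; *ₗ-zeroʳ     = λ x → *ₗ-zeroʳ (ι x)
          ; *ₗ-distribˡ  = λ x → *ₗ-distribˡ (ι x)
          }
        }
      ; -ᴹ‿cong    = -ᴹ‿cong
      ; -ᴹ‿inverse = -ᴹ‿inverse
      }
    }
    where open LeftModule M

module _ (X : Setoid c ℓ) where
  open Setoid X

  Image : (Carrier → Carrier) → Pred Carrier p → Pred Carrier (c ⊔ ℓ ⊔ p)
  Image f W x = ∃ λ w → w ∈ W × f w ≈ x

  -- Elements are compared as transformations of X, so that membership proofs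
  -- do not affect the number of elements.
  Stabilizer : {I : Set a} (act : I → Carrier → Carrier) (W : Pred Carrier p) →
               Setoid (a ⊔ c ⊔ ℓ ⊔ p) (c ⊔ ℓ)
  Stabilizer {I = I} act W = record
    { Carrier       = ∃ λ (g : I) → Image (act g) W ≐ W
    ; _≈_           = λ g h → ∀ x → act (proj₁ g) x ≈ act (proj₁ h) x
    ; isEquivalence = record
      { refl  = λ x → refl
      ; sym   = λ g≈h x → sym (g≈h x)
      ; trans = λ f≈g g≈h x → trans (f≈g x) (g≈h x)
      }
    }

module _ {R : Ring a ℓ₁} (V : LeftModule R b ℓ₂) where
  open LeftModule V

  GL : Set (a ⊔ b ⊔ ℓ₂)
  GL = ∃ (IsLeftModuleIsomorphism rawLeftModule rawLeftModule)

  GL-stabilizer : Pred Carrierᴹ p → Setoid (a ⊔ b ⊔ ℓ₂ ⊔ p) (b ⊔ ℓ₂)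
  GL-stabilizer = Stabilizer ≈ᴹ-setoid {I = GL} proj₁

module _ (K : Field c ℓ) where
  open Field K

  SingerCycle : Set (c ⊔ ℓ)
  SingerCycle = ∃ λ x → ¬ (x ≈ 0#)

  Singer-stabilizer : Pred Carrier p → Setoid (c ⊔ ℓ ⊔ p) (c ⊔ ℓ)
  Singer-stabilizer =
    Stabilizer setoid {I = SingerCycle} (λ h x → proj₁ h * x)

module Extension (F : Field a ℓ₁) (K : Field c ℓ)
                 {ι : Field.Carrier F → Field.Carrier K}
                 (ι-homo : IsRingHomomorphism (Field.rawRing F) (Field.rawRing K) ι)
                 where
  private
    module F = Field F
    module K = Field K

  K-over-F : LeftModule F.ring c ℓ
  K-over-F = restrictScalars {F = F.ring} {K = K.ring} ι-homo (leftModule {R = K.ring})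

  ⟨1,_⟩ : ∀ {r} → Vector K.Carrier r → Pred K.Carrier (a ⊔ ℓ)
  ⟨1, u ⟩ = Span K-over-F (K.1# ∷ u)

  module _ (V : LeftModule K.ring b ℓ₂) where
    open LeftModule V

    -- Y and u are indexed from 0, and the bounds make Y₁,…,Y_{k-1} and
    -- Y₁,…,Y_r initial segments of the family Y.
    T : ∀ {m k r} → Vector Carrierᴹ m → k ≤ 1 ℕ.+ m → r ≤ k ∸ 1 →
        Vector K.Carrier r → Pred Carrierᴹ (a ⊔ ℓ₂)
    T {k = k} Y k≤1+m r≤k-1 u =
      Span (restrictScalars {F = F.ring} {K = K.ring} ι-homo V)
        ((λ (i : Fin (k ∸ 1)) → Y (inject≤ i k-1≤m)) ++ (w ∷ []))
      where
      k-1≤m = m≤n+o⇒m∸n≤o k 1 k≤1+m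
      w = linearCombination V u (λ i → Y (inject≤ i (≤-trans r≤k-1 k-1≤m)))

module Submission where

-- Put ε = (1,u₁,…,u_r) and t = (−Σ uᵢYᵢ,Y₁,…,Y_r). Up to a factor from K, the only K-linear relation
-- between the members of t and Y_{r+1},…,Y_{k-1} is Σ εᵢtᵢ = 0. An element g of the stabilizer of T
-- maps this relation to another one, so g tᵢ = Σⱼ Xᵢⱼtⱼ for a matrix X over F with εX = hε for some
-- h ∈ K*, that is, h stabilizes ⟨1,u₁,…,u_r⟩. Conversely such an h determines X, hence g on
-- Y₁,…,Y_r. The images of Y_{r+1},…,Y_{k-1} are then any vectors of T that are F-independent modulo
-- ⟨t⟩, those of Y_k,…,Y_m any vectors of V that are K-independent modulo the K-span of
-- Y₁,…,Y_{k-1}, and counting both kinds of families one vector at a time gives the two products.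

open import Defs
open import Level using (Level; _⊔_)
open import Algebra.Bundles using (CommutativeMonoid; CommutativeRing; Ring)
open import Algebra.Module.Bundles using (LeftModule)
open import Algebra.Module.Construct.TensorUnit using (leftModule)
open import Algebra.Module.Morphism.Structures using (IsLeftModuleHomomorphism; IsLeftModuleIsomorphism)
open import Algebra.Morphism.Structures using (IsRingHomomorphism)
import Algebra.Properties.AbelianGroup as AbelianGroupProperties
import Algebra.Properties.CommutativeSemigroup as CommutativeSemigroupProperties
import Algebra.Properties.Monoid.Sum as MonoidSum
open import Data.Fin.Base using (Fin; zero; suc; combine; inject≤; join; punchOut; remQuot; splitAt; _↑ˡ_; _↑ʳ_)
open import Data.Fin.Permutation using (↔⇒≡)
open import Data.Fin.Properties using (_≟_; all?; any?; combine-injective; combine-remQuot; injective⇒≤; join-splitAt; punchOut-injective; splitAt-join; suc-injective; toℕ-inject≤; toℕ-injective; toℕ-↑ˡ)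
open import Data.List.Base as List using (map; upTo)
open import Data.List.Properties using (map-++; map-cong; upTo-∷ʳ)
open import Data.Nat.Base as ℕ using (ℕ; zero; suc; s≤s; _+_; _*_; _∸_; _^_; _≤_)
open import Data.Nat.ListAction using (product)
open import Data.Nat.ListAction.Properties using (product-++)
open import Data.Nat.Properties using (*-assoc; *-comm; *-identityʳ; +-comm; 1+n≰n; ^-*-assoc; m+n∸m≡n; m≤m+n; m≤n⇒∃[o]m+o≡n; ≤-trans)
open import Data.Product.Base using (∃; ∃₂; _×_; _,_; proj₁; proj₂)
open import Data.Product.Relation.Binary.Pointwise.NonDependent using (_×ₛ_)
open import Data.Sum.Base using (_⊎_; inj₁; inj₂)
open import Data.Sum.Properties using (inj₁-injective; inj₂-injective)
open import Data.Vec.Functional using (Vector; []; _∷_; _++_; drop; head; tail; take)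
open import Data.Vec.Functional.Properties using (lookup-++ˡ; lookup-++ʳ)
open import Data.Vec.Functional.Relation.Binary.Equality.Setoid using (≋-setoid)
import Data.Vec.Functional.Relation.Binary.Pointwise.Properties as Pointwise
import Data.Vec.Functional.Relation.Unary.All.Properties as All
import Function.Consequences.Setoid as Consequences
import Function.Construct.Composition as Composition
import Function.Construct.Symmetry as Symmetry
open import Function.Base using (_∘_; id)
open import Function.Bundles using (Inverse)
open import Function.Definitions using (Congruent; Injective; StrictlySurjective)
open import Function.Properties.Bijection using (Bijection⇒Inverse)
open import Relation.Binary.Bundles using (Setoid)
import Relation.Binary.Construct.On as On
open import Relation.Binary.Definitions using (_Respects_) renaming (Decidable to Decidable₂)
open import Relation.Binary.PropositionalEquality as ≡ using (_≡_; cong; cong₂; refl; subst)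
import Relation.Binary.Reasoning.Setoid as SetoidReasoning
open import Relation.Nullary using (¬_; Dec; yes; no; ¬?; _×-dec_; contradiction)
open import Relation.Nullary.Decidable using (map′)
open import Relation.Unary using (Decidable; Pred; _∈_; _∉_; _⊆_; _≐_; ∁)

-- The sign in t₀ = -Σ uᵢYᵢ makes the relation homogeneous in generators of T, so that its image
-- under g can be compared with the relation itself. Written in F-coordinates, the image has
-- coefficients that are F-combinations of the εᵢ. Those at Y_{r+1},...,Y_{k-1} vanish, and since ε
-- is independent over F, every F-coordinate entering them vanishes too; this is why g tᵢ involves
-- no vector outside ⟨t⟩. The rows of X describe g on t and its columns describe h on ε, so
-- independence of t and of ε lets g on t and h determine each other.
--
-- Invertibility never goes through determinants or dimension theory. All scalars are finite, so a
-- family of n vectors whose span lies in a set of Qⁿ elements is independent exactly when it spans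
-- that set. This one principle turns hU ⊆ U into equality, shows that the images under g are
-- independent extensions, and shows that prescribed images define an automorphism.
--
-- In the products, r+1 is the F-dimension of ⟨t⟩ and k-1 the K-dimension of the K-span of T: the
-- sizes of the families that are already fixed when the choices begin.

private
  variable
    a b c p ℓ ℓ₁ ℓ₂ : Level
    m n : ℕ

-- Sizes of setoids

-- Equality forgets the proof of `P`. Membership proofs for spans carry coefficient vectors, so
-- comparing them would distort the count.
SubSetoid : (S : Setoid a ℓ) → Pred (Setoid.Carrier S) p → Setoid (a ⊔ p) ℓ
SubSetoid S P = On.setoid {B = ∃ P} S proj₁

module _ {S : Setoid a ℓ₁} {T : Setoid b ℓ₂} where
  private
    module S = Setoid S
    module T = Setoid T

  bijection⇒inverse : (f : S.Carrier → T.Carrier) → Congruent S._≈_ T._≈_ f →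
                      Injective S._≈_ T._≈_ f → StrictlySurjective T._≈_ f → Inverse S T
  bijection⇒inverse f f-cong f-inj f-surj = Bijection⇒Inverse record
    { to        = f
    ; cong      = f-cong
    ; bijective = f-inj ,
        Consequences.strictlySurjective⇒surjective S T f-cong f-surj
    }

  to-injective : (S↔T : Inverse S T) → Injective S._≈_ T._≈_ (Inverse.to S↔T)
  to-injective S↔T {x} {y} eq = S.trans (S.sym (strictlyInverseʳ x)) (S.trans (from-cong eq) (strictlyInverseʳ y))
    where open Inverse S↔T

  HasSize-resp : Inverse S T → HasSize T n → HasSize S n
  HasSize-resp = Composition.inverse

module _ {S : Setoid a ℓ} where
  open Setoid S

  HasSize-unique : HasSize S m → HasSize S n → m ≡ n
  HasSize-unique S↔m S↔n = ↔⇒≡ (HasSize-resp (Symmetry.inverse S↔m) S↔n)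

  decidableEquality : HasSize S n → Decidable₂ _≈_
  decidableEquality S↔n x y =
    map′ (to-injective S↔n) to-cong (to x ≟ to y)
    where open Inverse S↔n

  search : HasSize S n → {P : Pred Carrier p} → P Respects _≈_ → Decidable P → Dec (∃ P)
  search S↔n resp P? =
    map′ (λ (i , Pi) → from i , Pi) (λ (x , Px) → to x , resp (sym (strictlyInverseʳ x)) Px)
         (any? (P? ∘ from))
    where open Inverse S↔n

-- If `y` were missed, punching it out of the codomain would inject `Fin (suc n)` into `Fin n`.
injective⇒surjective-Fin : {f : Fin n → Fin n} → Injective _≡_ _≡_ f → StrictlySurjective _≡_ f
injective⇒surjective-Fin {suc n} {f} f-inj y with any? (λ x → f x ≟ y)
... | yes hit = hit
... | no miss = contradiction
  (injective⇒≤ {f = λ x → punchOut (miss′ x)} (λ eq → f-inj (punchOut-injective (miss′ _) (miss′ _) eq)))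
  1+n≰n
  where
  miss′ : ∀ x → ¬ (y ≡ f x)
  miss′ x eq = miss (x , ≡.sym eq)

module _ {S : Setoid a ℓ₁} {T : Setoid b ℓ₂} (S↔n : HasSize S n) (T↔n : HasSize T n) where
  private
    module S = Setoid S
    module T = Setoid T
    module S↔ = Inverse S↔n
    module T↔ = Inverse T↔n

  injective⇒surjective : {f : S.Carrier → T.Carrier} → Congruent S._≈_ T._≈_ f →
                         Injective S._≈_ T._≈_ f → StrictlySurjective T._≈_ f
  injective⇒surjective {f} f-cong f-inj y = S↔.from (proj₁ preimage) , to-injective T↔n (proj₂ preimage)
    where
    preimage : ∃ λ i → T↔.to (f (S↔.from i)) ≡ T↔.to y
    preimage = injective⇒surjective-Fin
      (λ eq → to-injective (Symmetry.inverse S↔n) (f-inj (to-injective T↔n eq))) (T↔.to y)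

module _ {S : Setoid a ℓ₁} {T : Setoid b ℓ₂} (S↔n : HasSize S n) (T↔n : HasSize T n) where
  private
    module S = Setoid S
    module T = Setoid T

  surjective⇒injective : {f : S.Carrier → T.Carrier} → Congruent S._≈_ T._≈_ f →
                         StrictlySurjective T._≈_ f → Injective S._≈_ T._≈_ f
  surjective⇒injective {f} f-cong f-surj {x} {y} fx≈fy =
    S.trans (S.sym (proj₂ (g-surj x))) (S.trans (g-cong (T.trans (T.sym (f-g-surj x))
      (T.trans fx≈fy (f-g-surj y)))) (proj₂ (g-surj y)))
    where
    -- The preimages given by `f-surj` need not respect equality. Taking them at the representative
    -- `from (to t)` yields a congruent section, which is injective and hence surjective by
    -- counting.
    g : T.Carrier → S.Carrier
    g t = Inverse.from S↔n (Inverse.to S↔n (proj₁ (f-surj (Inverse.from T↔n (Inverse.to T↔n t)))))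
    fg : ∀ t → f (g t) T.≈ t
    fg t = T.trans (f-cong (Inverse.strictlyInverseʳ S↔n _))
             (T.trans (proj₂ (f-surj _)) (Inverse.strictlyInverseʳ T↔n t))
    g-cong : Congruent T._≈_ S._≈_ g
    g-cong t≈t′ = S.reflexive
      (cong (λ i → Inverse.from S↔n (Inverse.to S↔n (proj₁ (f-surj (Inverse.from T↔n i)))))
            (Inverse.to-cong T↔n t≈t′))
    g-surj : StrictlySurjective S._≈_ g
    g-surj = injective⇒surjective T↔n S↔n g-cong
      (λ eq → T.trans (T.sym (fg _)) (T.trans (f-cong eq) (fg _)))
    f-g-surj : ∀ x → f x T.≈ proj₁ (g-surj x)
    f-g-surj x = T.trans (f-cong (S.sym (proj₂ (g-surj x)))) (fg _)

Fibre : (X : Setoid a ℓ₁) (B : Setoid b ℓ₂) → (Setoid.Carrier X → Setoid.Carrier B) →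
        Setoid.Carrier B → Setoid (a ⊔ ℓ₂) ℓ₁
Fibre X B f y = SubSetoid X (λ x → Setoid._≈_ B (f x) y)

module _ {X : Setoid a ℓ₁} {B : Setoid b ℓ₂} {f : Setoid.Carrier X → Setoid.Carrier B} where
  private
    module X = Setoid X
    module B = Setoid B

  HasSize-fibres : Congruent X._≈_ B._≈_ f → HasSize B m →
                   (∀ y → HasSize (Fibre X B f y) n) → HasSize X (m * n)
  HasSize-fibres {m} {n} f-cong B↔m fibre↔n =
    bijection⇒inverse encode encode-cong encode-injective encode-surjective
    where
    module B↔ = Inverse B↔m
    module Fib i = Inverse (fibre↔n (B↔.from i))
    rep : ∀ x → f x B.≈ B↔.from (B↔.to (f x))
    rep x = B.sym (B↔.strictlyInverseʳ (f x))
    encode : X.Carrier → Fin (m * n)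
    encode x = combine (B↔.to (f x)) (Fib.to (B↔.to (f x)) (x , rep x))
    -- The type of the second coordinate depends on the first. Freeing the indices and the
    -- membership proofs lets `i ≡ j` be matched with `refl`.
    encode-cong-at : ∀ {i j x y} (p : f x B.≈ B↔.from i) (q : f y B.≈ B↔.from j) → i ≡ j → x X.≈ y →
                 combine i (Fib.to i (x , p)) ≡ combine j (Fib.to j (y , q))
    encode-cong-at {i} p q refl x≈y = cong (combine i) (Fib.to-cong i x≈y)
    encode-cong : Congruent X._≈_ _≡_ encode
    encode-cong x≈y = encode-cong-at (rep _) (rep _) (B↔.to-cong (f-cong x≈y)) x≈y
    encode-injective-at : ∀ {i j x y} (p : f x B.≈ B↔.from i) (q : f y B.≈ B↔.from j) → i ≡ j →
                      Fib.to i (x , p) ≡ Fib.to j (y , q) → x X.≈ y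
    encode-injective-at {i} p q refl eq = to-injective (fibre↔n (B↔.from i)) eq
    encode-injective : Injective X._≈_ _≡_ encode
    encode-injective {x} {y} eq with i≡j , k≡l ← combine-injective (B↔.to (f x)) _ _ _ eq =
      encode-injective-at (rep x) (rep y) i≡j k≡l
    encode-surjective : StrictlySurjective _≡_ encode
    encode-surjective c with i , j ← remQuot {m} n c in eq = x , ≡.trans
      (≡.trans (encode-cong-at (rep x) x∈ (≡.trans (B↔.to-cong x∈) (B↔.strictlyInverseˡ i)) X.refl)
               (cong (combine i) (Fib.strictlyInverseˡ i j)))
      (≡.trans (cong (λ ij → combine {m} (proj₁ ij) (proj₂ ij)) (≡.sym eq)) (combine-remQuot {m} n c))
      where
      x = proj₁ (Fib.from i j)
      x∈ = proj₂ (Fib.from i j)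

HasSize-× : {S : Setoid a ℓ₁} {T : Setoid b ℓ₂} → HasSize S m → HasSize T n → HasSize (S ×ₛ T) (m * n)
HasSize-× {S = S} {T = T} S↔m T↔n = HasSize-fibres {f = proj₁} proj₁ S↔m (λ x → HasSize-resp (bijection⇒inverse
  (proj₂ ∘ proj₁) proj₂ (λ { {_ , p} {_ , q} y≈ → Setoid.trans S p (Setoid.sym S q) , y≈ })
  (λ y → ((x , y) , Setoid.refl S) , Setoid.refl T)) T↔n)

HasSize-one : {S : Setoid a ℓ} → (x : Setoid.Carrier S) → (∀ y z → Setoid._≈_ S y z) → HasSize S 1
HasSize-one x all≈ = bijection⇒inverse (λ _ → zero) (λ _ → refl) (λ _ → all≈ _ _) (λ { zero → x , refl })

HasSize-Vector : {S : Setoid a ℓ} → HasSize S m → ∀ n → HasSize (≋-setoid S n) (m ^ n)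
HasSize-Vector S↔m zero = HasSize-one [] (λ _ _ ())
HasSize-Vector {S = S} S↔m (suc n) =
  HasSize-fibres {f = λ xs → xs zero} (λ xs≋ys → xs≋ys zero) S↔m (λ y →
    HasSize-resp (bijection⇒inverse
      (λ (xs , _) i → xs (suc i))
      (λ xs≋ys i → xs≋ys (suc i))
      (λ { {_ , p} {_ , q} xs≋ys zero → Setoid.trans S p (Setoid.sym S q) ; xs≋ys (suc i) → xs≋ys i })
      (λ xs → (y ∷ xs , Setoid.refl S) , (λ i → Setoid.refl S)))
    (HasSize-Vector S↔m n))

HasSize-decidable-Fin : {P : Pred (Fin n) p} → Decidable P → ∃ (HasSize (SubSetoid (≡.setoid (Fin n)) P))
HasSize-decidable-Fin {n = zero} P? = 0 , bijection⇒inverse (λ { (() , _) }) (λ { {() , _} }) (λ { {() , _} }) (λ ())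
HasSize-decidable-Fin {n = suc n} {P = P} P? with P? zero | HasSize-decidable-Fin (P? ∘ suc)
... | no ¬P0 | c , P↔c = c , HasSize-resp (bijection⇒inverse pred pred-cong
    (λ { {zero , P0} → contradiction P0 ¬P0 ; {suc i , _} {zero , P0} → contradiction P0 ¬P0
       ; {suc i , _} {suc j , _} → cong suc })
    (λ (i , Pi) → (suc i , Pi) , refl)) P↔c
  where
  pred : ∃ P → ∃ (P ∘ suc)
  pred (zero  , P0) = contradiction P0 ¬P0
  pred (suc i , Pi) = i , Pi
  pred-cong : ∀ {x y} → proj₁ x ≡ proj₁ y → proj₁ (pred x) ≡ proj₁ (pred y)
  pred-cong {zero , P0} refl = contradiction P0 ¬P0
  pred-cong {suc i , _} refl = refl
... | yes P0 | c , P↔c = suc c , bijection⇒inverse encode encode-cong encode-injective encode-surjective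
  where
  module P↔ = Inverse P↔c
  encode : ∃ P → Fin (suc c)
  encode (zero  , _)  = zero
  encode (suc i , Pi) = suc (P↔.to (i , Pi))
  encode-cong : ∀ {x y} → proj₁ x ≡ proj₁ y → encode x ≡ encode y
  encode-cong {zero  , _} refl = refl
  encode-cong {suc i , _} refl = cong suc (P↔.to-cong refl)
  encode-injective : ∀ {x y} → encode x ≡ encode y → proj₁ x ≡ proj₁ y
  encode-injective {zero  , _} {zero  , _} eq = refl
  encode-injective {suc i , _} {suc j , _} eq = cong suc (to-injective P↔c (suc-injective eq))
  encode-surjective : StrictlySurjective _≡_ encode
  encode-surjective zero    = (zero , P0) , refl
  encode-surjective (suc i) = (suc (proj₁ (P↔.from i)) , proj₂ (P↔.from i)) , cong suc (P↔.strictlyInverseˡ i)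

module _ {S : Setoid a ℓ} where
  open Setoid S hiding (refl)

  HasSize-decidable : HasSize S n → {P : Pred Carrier p} → P Respects _≈_ → Decidable P →
                      ∃ (HasSize (SubSetoid S P))
  HasSize-decidable S↔n resp P? with c , P↔c ← HasSize-decidable-Fin (P? ∘ Inverse.from S↔n) =
    c , HasSize-resp (bijection⇒inverse
      (λ (x , Px) → to x , resp (sym (strictlyInverseʳ x)) Px)
      to-cong
      (to-injective S↔n)
      (λ (i , Pi) → (from i , Pi) , strictlyInverseˡ i)) P↔c
    where open Inverse S↔n

  HasSize-join : {P : Pred Carrier p} → P Respects _≈_ → Decidable P →
                 HasSize (SubSetoid S P) m → HasSize (SubSetoid S (∁ P)) n → HasSize S (m + n)
  HasSize-join {m = m} {n = n} {P = P} resp P? P↔m ∁P↔n =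
    bijection⇒inverse encode encode-cong encode-injective encode-surjective
    where
    module P↔ = Inverse P↔m
    module ∁P↔ = Inverse ∁P↔n
    side : ∀ x → Dec (P x) → Fin m ⊎ Fin n
    side x (yes Px) = inj₁ (P↔.to (x , Px))
    side x (no ¬Px) = inj₂ (∁P↔.to (x , ¬Px))
    side-cong : ∀ {x y} d d′ → x ≈ y → side x d ≡ side y d′
    side-cong (yes _)  (yes _)  x≈y = cong inj₁ (P↔.to-cong x≈y)
    side-cong (yes Px) (no ¬Py) x≈y = contradiction (resp x≈y Px) ¬Py
    side-cong (no ¬Px) (yes Py) x≈y = contradiction (resp (sym x≈y) Py) ¬Px
    side-cong (no _)   (no _)   x≈y = cong inj₂ (∁P↔.to-cong x≈y)
    side-injective : ∀ {x y} d d′ → side x d ≡ side y d′ → x ≈ y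
    side-injective (yes _) (yes _) eq = to-injective P↔m (inj₁-injective eq)
    side-injective (no _)  (no _)  eq = to-injective ∁P↔n (inj₂-injective eq)
    encode : Carrier → Fin (m + n)
    encode x = join m n (side x (P? x))
    encode-cong : Congruent _≈_ _≡_ encode
    encode-cong x≈y = cong (join m n) (side-cong (P? _) (P? _) x≈y)
    encode-injective : Injective _≈_ _≡_ encode
    encode-injective {x} {y} eq = side-injective (P? x) (P? y)
      (≡.trans (≡.sym (splitAt-join m n _)) (≡.trans (cong (splitAt m) eq) (splitAt-join m n _)))
    -- Quantifying over every decision `d` allows the use at `P? x`, whose value is unknown.
    side-surjective : ∀ s → ∃ λ x → ∀ d → side x d ≡ s
    side-surjective (inj₁ i) = proj₁ (P↔.from i) , λ
      { (yes _)  → cong inj₁ (≡.trans (P↔.to-cong (Setoid.refl S)) (P↔.strictlyInverseˡ i))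
      ; (no ¬Px) → contradiction (proj₂ (P↔.from i)) ¬Px }
    side-surjective (inj₂ i) = proj₁ (∁P↔.from i) , λ
      { (yes Px) → contradiction Px (proj₂ (∁P↔.from i))
      ; (no _)   → cong inj₂ (≡.trans (∁P↔.to-cong (Setoid.refl S)) (∁P↔.strictlyInverseˡ i)) }
    encode-surjective : StrictlySurjective _≡_ encode
    encode-surjective i with x , side≡ ← side-surjective (splitAt m i) =
      x , ≡.trans (cong (join m n) (side≡ (P? x))) (join-splitAt m n i)

  -- Decidability gives the complement some size `c`; joining both halves and uniqueness of sizes
  -- force `m + c ≡ n`.
  HasSize-∁ : {P : Pred Carrier p} → P Respects _≈_ → Decidable P →
              HasSize S n → HasSize (SubSetoid S P) m → HasSize (SubSetoid S (∁ P)) (n ∸ m)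
  HasSize-∁ {n = n} {m = m} resp P? S↔n P↔m
    with c , ∁P↔c ← HasSize-decidable S↔n (λ x≈y ¬Px Py → ¬Px (resp (sym x≈y) Py)) (¬? ∘ P?) =
    subst (HasSize _) (≡.trans (≡.sym (m+n∸m≡n m c))
      (cong (_∸ m) (HasSize-unique (HasSize-join resp P? P↔m ∁P↔c) S↔n))) ∁P↔c

-- Linear combinations

++-suc : {A : Set a} (v : Vector A (suc m)) (w : Vector A n) → ∀ i → (v ++ w) (suc i) ≡ (tail v ++ w) i
++-suc {m = m} v w i with splitAt m i
... | inj₁ _ = ≡.refl
... | inj₂ _ = ≡.refl

∷-++ : {A : Set a} (x : A) (v : Vector A m) (w : Vector A n) → ∀ i → ((x ∷ v) ++ w) i ≡ (x ∷ (v ++ w)) i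
∷-++ x v w zero    = ≡.refl
∷-++ x v w (suc i) = ++-suc (x ∷ v) w i

↑-cases : (P : Pred (Fin (m ℕ.+ n)) p) → (∀ i → P (i ↑ˡ n)) → (∀ j → P (m ↑ʳ j)) → ∀ i → P i
↑-cases {m = m} {n = n} P Pˡ Pʳ i = ≡.subst P (join-splitAt m n i)
  (All.++⁺ P {xs = _↑ˡ n} {ys = m ↑ʳ_} Pˡ Pʳ i)

module UnitVectors (R : Ring a ℓ₁) where
  private module R = Ring R

  δ : Fin n → Vector R.Carrier n
  δ zero    = R.1# ∷ (λ _ → R.0#)
  δ (suc i) = R.0# ∷ δ i

  δ-sym : (i j : Fin n) → δ i j ≡ δ j i
  δ-sym zero    zero    = ≡.refl
  δ-sym zero    (suc j) = ≡.refl
  δ-sym (suc i) zero    = ≡.refl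
  δ-sym (suc i) (suc j) = δ-sym i j

module LinearCombinations {R : Ring a ℓ₁} (M : LeftModule R b ℓ₂) where
  private module R = Ring R
  open LeftModule M
  open SetoidReasoning ≈ᴹ-setoid
  open CommutativeSemigroupProperties
    (CommutativeMonoid.commutativeSemigroup +ᴹ-commutativeMonoid)
    using (interchange)
  open AbelianGroupProperties +ᴹ-abelianGroup using () renaming (inverseˡ-unique to inverseˡ-uniqueᴹ)

  open UnitVectors R public

  LC : Vector R.Carrier n → Vector Carrierᴹ n → Carrierᴹ
  LC = linearCombination M

  LCᴿ : Vector R.Carrier n → Vector R.Carrier n → R.Carrier
  LCᴿ = linearCombination (leftModule {R = R})

  LC-cong : {α β : Vector R.Carrier n} {v w : Vector Carrierᴹ n} →
            (∀ i → α i R.≈ β i) → (∀ i → v i ≈ᴹ w i) → LC α v ≈ᴹ LC β w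
  LC-cong α≋β v≋w = MonoidSum.sum-cong-≋ +ᴹ-monoid (λ i → *ₗ-cong (α≋β i) (v≋w i))

  LC-congˡ : {α β : Vector R.Carrier n} {v : Vector Carrierᴹ n} →
             (∀ i → α i R.≈ β i) → LC α v ≈ᴹ LC β v
  LC-congˡ α≋β = LC-cong α≋β (λ _ → ≈ᴹ-refl)

  LC-congʳ : {α : Vector R.Carrier n} {v w : Vector Carrierᴹ n} →
             (∀ i → v i ≈ᴹ w i) → LC α v ≈ᴹ LC α w
  LC-congʳ v≋w = LC-cong (λ _ → R.refl) v≋w

  LC-zeroˡ : (v : Vector Carrierᴹ n) → LC (λ _ → R.0#) v ≈ᴹ 0ᴹ
  LC-zeroˡ {zero}  v = ≈ᴹ-refl
  LC-zeroˡ {suc n} v = ≈ᴹ-trans (+ᴹ-cong (*ₗ-zeroˡ _) (LC-zeroˡ (tail v))) (+ᴹ-identityˡ 0ᴹ)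

  LC-+ : (α β : Vector R.Carrier n) (v : Vector Carrierᴹ n) →
         LC (λ i → α i R.+ β i) v ≈ᴹ LC α v +ᴹ LC β v
  LC-+ {zero}  α β v = ≈ᴹ-sym (+ᴹ-identityˡ 0ᴹ)
  LC-+ {suc n} α β v = ≈ᴹ-trans (+ᴹ-cong (*ₗ-distribʳ _ _ _) (LC-+ (tail α) (tail β) (tail v))) (interchange _ _ _ _)

  LC-* : ∀ x (α : Vector R.Carrier n) (v : Vector Carrierᴹ n) →
         LC (λ i → x R.* α i) v ≈ᴹ x *ₗ LC α v
  LC-* {zero}  x α v = ≈ᴹ-sym (*ₗ-zeroʳ x)
  LC-* {suc n} x α v = ≈ᴹ-trans (+ᴹ-cong (*ₗ-assoc _ _ _) (LC-* x (tail α) (tail v))) (≈ᴹ-sym (*ₗ-distribˡ x _ _))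

  LC-++ : (α : Vector R.Carrier (m ℕ.+ n)) (v : Vector Carrierᴹ m) (w : Vector Carrierᴹ n) →
          LC α (v ++ w) ≈ᴹ LC (take m α) v +ᴹ LC (drop m α) w
  LC-++ {zero}  α v w = ≈ᴹ-sym (+ᴹ-identityˡ _)
  LC-++ {suc m} α v w = begin
    α zero *ₗ head v +ᴹ LC (tail α) (tail (v ++ w))
      ≈⟨ +ᴹ-congˡ (LC-congʳ (λ i → ≈ᴹ-reflexive (++-suc v w i))) ⟩
    α zero *ₗ head v +ᴹ LC (tail α) (tail v ++ w)
      ≈⟨ +ᴹ-congˡ (LC-++ (tail α) (tail v) w) ⟩
    α zero *ₗ head v +ᴹ (LC (take m (tail α)) (tail v) +ᴹ LC (drop m (tail α)) w)
      ≈⟨ +ᴹ-assoc _ _ _ ⟨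
    LC (take (suc m) α) v +ᴹ LC (drop (suc m) α) w ∎

  LC-LC : (α : Vector R.Carrier m) (A : Fin m → Vector R.Carrier n) (v : Vector Carrierᴹ n) →
          LC α (λ i → LC (A i) v) ≈ᴹ LC (λ j → LCᴿ α (λ i → A i j)) v
  LC-LC {zero}  α A v = ≈ᴹ-sym (LC-zeroˡ v)
  LC-LC {suc m} α A v = begin
    α zero *ₗ LC (A zero) v +ᴹ LC (tail α) (λ i → LC (A (suc i)) v)
      ≈⟨ +ᴹ-cong (≈ᴹ-sym (LC-* _ _ v)) (LC-LC (tail α) (tail A) v) ⟩
    LC (λ j → α zero R.* A zero j) v +ᴹ LC (λ j → LCᴿ (tail α) (λ i → A (suc i) j)) v
      ≈⟨ LC-+ _ _ v ⟨
    LC (λ j → LCᴿ α (λ i → A i j)) v ∎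

  LC-δ : (i : Fin n) (v : Vector Carrierᴹ n) → LC (δ i) v ≈ᴹ v i
  LC-δ zero    v = ≈ᴹ-trans (+ᴹ-cong (*ₗ-identityˡ _) (LC-zeroˡ (tail v))) (+ᴹ-identityʳ _)
  LC-δ (suc i) v = ≈ᴹ-trans (+ᴹ-cong (*ₗ-zeroˡ _) (LC-δ i (tail v))) (+ᴹ-identityˡ _)

  Span-resp : {v : Vector Carrierᴹ n} → Span M v Respects _≈ᴹ_
  Span-resp x≈y (α , x≈) = α , ≈ᴹ-trans (≈ᴹ-sym x≈y) x≈

  Span-generator : (v : Vector Carrierᴹ n) → ∀ i → v i ∈ Span M v
  Span-generator v i = δ i , ≈ᴹ-sym (LC-δ i v)

  Span-LC : (α : Vector R.Carrier m) {x : Vector Carrierᴹ m} {v : Vector Carrierᴹ n} →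
            (∀ i → x i ∈ Span M v) → LC α x ∈ Span M v
  Span-LC α x∈ = _ , ≈ᴹ-trans (LC-congʳ (proj₂ ∘ x∈)) (LC-LC α (proj₁ ∘ x∈) _)

  Span-least : {x : Vector Carrierᴹ m} {v : Vector Carrierᴹ n} →
               (∀ i → x i ∈ Span M v) → Span M x ⊆ Span M v
  Span-least x∈ (α , y≈) = Span-resp (≈ᴹ-sym y≈) (Span-LC α x∈)

  Span--ᴹ : ∀ {x} {v : Vector Carrierᴹ n} → x ∈ Span M v → -ᴹ x ∈ Span M v
  Span--ᴹ {x = x} {v} (α , x≈) = (λ i → R.- R.1# R.* α i) , ≈ᴹ-sym (begin
    LC (λ i → R.- R.1# R.* α i) v  ≈⟨ LC-* _ α v ⟩
    R.- R.1# *ₗ LC α v             ≈⟨ *ₗ-congˡ x≈ ⟨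
    R.- R.1# *ₗ x                  ≈⟨ inverseˡ-uniqueᴹ _ _ -1x+x≈0 ⟩
    -ᴹ x                           ∎)
    where
    -1x+x≈0 : R.- R.1# *ₗ x +ᴹ x ≈ᴹ 0ᴹ
    -1x+x≈0 = begin
      R.- R.1# *ₗ x +ᴹ x             ≈⟨ +ᴹ-congˡ (*ₗ-identityˡ x) ⟨
      R.- R.1# *ₗ x +ᴹ R.1# *ₗ x     ≈⟨ *ₗ-distribʳ x _ _ ⟨
      (R.- R.1# R.+ R.1#) *ₗ x       ≈⟨ *ₗ-congʳ (R.-‿inverseˡ R.1#) ⟩
      R.0# *ₗ x                      ≈⟨ *ₗ-zeroˡ x ⟩
      0ᴹ                             ∎

  Span-++ˡ : (v : Vector Carrierᴹ m) (w : Vector Carrierᴹ n) → Span M v ⊆ Span M (v ++ w)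
  Span-++ˡ v w = Span-least λ i →
    Span-resp (≈ᴹ-reflexive (lookup-++ˡ v w i)) (Span-generator (v ++ w) _)

  Span-++ʳ : (v : Vector Carrierᴹ m) (w : Vector Carrierᴹ n) → Span M w ⊆ Span M (v ++ w)
  Span-++ʳ v w = Span-least λ i →
    Span-resp (≈ᴹ-reflexive (lookup-++ʳ v w i)) (Span-generator (v ++ w) _)

  Span-++-least : {x : Vector Carrierᴹ m} {y : Vector Carrierᴹ n} {k : ℕ} {v : Vector Carrierᴹ k} →
                  (∀ i → x i ∈ Span M v) → (∀ i → y i ∈ Span M v) → Span M (x ++ y) ⊆ Span M v
  Span-++-least {v = v} x∈ y∈ = Span-least (All.++⁺ (Span M v) x∈ y∈)

  LC-injective : {v : Vector Carrierᴹ n} → LinearlyIndependent M v →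
                 (α β : Vector R.Carrier n) → LC α v ≈ᴹ LC β v → ∀ i → α i R.≈ β i
  LC-injective {v = v} v-LI α β eq i = R-eq (v-LI (λ i → α i R.+ R.- R.1# R.* β i) (begin
      LC (λ i → α i R.+ R.- R.1# R.* β i) v        ≈⟨ LC-+ _ _ v ⟩
      LC α v +ᴹ LC (λ i → R.- R.1# R.* β i) v      ≈⟨ +ᴹ-cong eq (LC-* _ β v) ⟩
      LC β v +ᴹ R.- R.1# *ₗ LC β v                 ≈⟨ +ᴹ-congʳ (*ₗ-identityˡ _) ⟨
      R.1# *ₗ LC β v +ᴹ R.- R.1# *ₗ LC β v         ≈⟨ *ₗ-distribʳ _ _ _ ⟨
      (R.1# R.+ R.- R.1#) *ₗ LC β v                ≈⟨ *ₗ-congʳ (R.-‿inverseʳ R.1#) ⟩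
      R.0# *ₗ LC β v                               ≈⟨ *ₗ-zeroˡ _ ⟩
      0ᴹ                                           ∎) i)
    where
    open import Algebra.Properties.Ring R using (-1*x≈-x)
    R-eq : ∀ {x y} → x R.+ R.- R.1# R.* y R.≈ R.0# → x R.≈ y
    R-eq {x} {y} eq = AbelianGroupProperties.x∙y⁻¹≈ε⇒x≈y R.+-abelianGroup x y
      (R.trans (R.+-congˡ (R.sym (-1*x≈-x y))) eq)

  LinearlyIndependent-resp : {v w : Vector Carrierᴹ n} → (∀ i → v i ≈ᴹ w i) →
                             LinearlyIndependent M v → LinearlyIndependent M w
  LinearlyIndependent-resp v≋w v-LI α eq = v-LI α (≈ᴹ-trans (LC-congʳ v≋w) eq)

  Span-cong : {v w : Vector Carrierᴹ n} → (∀ i → v i ≈ᴹ w i) → Span M v ⊆ Span M w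
  Span-cong v≋w (α , x≈) = α , ≈ᴹ-trans x≈ (LC-congʳ v≋w)

  independent-++ : {v : Vector Carrierᴹ m} {w : Vector Carrierᴹ n} → LinearlyIndependent M (v ++ w) →
    (α : Vector R.Carrier m) (β : Vector R.Carrier n) → LC α v +ᴹ LC β w ≈ᴹ 0ᴹ →
    (∀ i → α i R.≈ R.0#) × (∀ j → β j R.≈ R.0#)
  independent-++ {m = m} {v = v} {w} vw-LI α β eq =
    All.++⁻ (R._≈ R.0#) α {ys = β} (vw-LI (α ++ β) (begin
      LC (α ++ β) (v ++ w)                                ≈⟨ LC-++ (α ++ β) v w ⟩
      LC (take m (α ++ β)) v +ᴹ LC (drop m (α ++ β)) w
        ≈⟨ +ᴹ-cong (LC-congˡ (R.reflexive ∘ lookup-++ˡ α β)) (LC-congˡ (R.reflexive ∘ lookup-++ʳ α β)) ⟩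
      LC α v +ᴹ LC β w                                    ≈⟨ eq ⟩
      0ᴹ                                                  ∎))

  LinearlyIndependent-++⁻ˡ : (v : Vector Carrierᴹ m) (w : Vector Carrierᴹ n) →
    LinearlyIndependent M (v ++ w) → LinearlyIndependent M v
  LinearlyIndependent-++⁻ˡ v w vw-LI α eq = proj₁ (independent-++ vw-LI α (λ _ → R.0#)
    (≈ᴹ-trans (+ᴹ-cong eq (LC-zeroˡ w)) (+ᴹ-identityˡ 0ᴹ)))

  LinearlyIndependent-++⁻ʳ : (v : Vector Carrierᴹ m) (w : Vector Carrierᴹ n) →
    LinearlyIndependent M (v ++ w) → LinearlyIndependent M w
  LinearlyIndependent-++⁻ʳ v w vw-LI β eq = proj₂ (independent-++ vw-LI (λ _ → R.0#) β
    (≈ᴹ-trans (+ᴹ-cong (LC-zeroˡ v) eq) (+ᴹ-identityˡ 0ᴹ)))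

  private
    IsEndomorphism = IsLeftModuleHomomorphism rawLeftModule rawLeftModule
    IsAutomorphism = IsLeftModuleIsomorphism rawLeftModule rawLeftModule

  LC-map : {f : Carrierᴹ → Carrierᴹ} → IsEndomorphism f →
           (α : Vector R.Carrier n) (v : Vector Carrierᴹ n) → f (LC α v) ≈ᴹ LC α (f ∘ v)
  LC-map {n = zero}  f-homo α v = IsLeftModuleHomomorphism.0ᴹ-homo f-homo
  LC-map {n = suc n} f-homo α v = ≈ᴹ-trans (+ᴹ-homo _ _)
    (+ᴹ-cong (*ₗ-homo _ _) (LC-map f-homo (tail α) (tail v)))
    where open IsLeftModuleHomomorphism f-homo

  module _ {Y : Vector Carrierᴹ n} (Y-LI : LinearlyIndependent M Y) (Y-spans : ∀ x → x ∈ Span M Y)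
           (Z : Vector Carrierᴹ n) where

    linearExtension : Carrierᴹ → Carrierᴹ
    linearExtension x = LC (proj₁ (Y-spans x)) Z

    -- Uniqueness of coordinates makes the value independent of the choice made by `Y-spans`; every
    -- homomorphism law below reduces to this.
    linearExtension-LC : ∀ {x} α → x ≈ᴹ LC α Y → linearExtension x ≈ᴹ LC α Z
    linearExtension-LC {x} α x≈ =
      LC-congˡ (LC-injective Y-LI _ α (≈ᴹ-trans (≈ᴹ-sym (proj₂ (Y-spans x))) x≈))

    linearExtension-generator : ∀ i → linearExtension (Y i) ≈ᴹ Z i
    linearExtension-generator i =
      ≈ᴹ-trans (linearExtension-LC (δ i) (≈ᴹ-sym (LC-δ i Y))) (LC-δ i Z)

    linearExtension-isHomomorphism : IsEndomorphism linearExtension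
    linearExtension-isHomomorphism = record
      { +ᴹ-isGroupHomomorphism = record
        { isMonoidHomomorphism = record
          { isMagmaHomomorphism = record
            { isRelHomomorphism = record { cong = f-cong }
            ; homo              = f-+
            }
          ; ε-homo = f-0
          }
        ; ⁻¹-homo = λ x → inverseˡ-uniqueᴹ _ _ (begin
            f (-ᴹ x) +ᴹ f x  ≈⟨ f-+ (-ᴹ x) x ⟨
            f (-ᴹ x +ᴹ x)    ≈⟨ f-cong (-ᴹ‿inverseˡ x) ⟩
            f 0ᴹ             ≈⟨ f-0 ⟩
            0ᴹ               ∎)
        }
      ; *ₗ-homo = λ c x → ≈ᴹ-trans
          (linearExtension-LC _ (≈ᴹ-trans (*ₗ-congˡ (proj₂ (Y-spans x))) (≈ᴹ-sym (LC-* c _ Y))))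
          (LC-* c _ Z)
      }
      where
      f = linearExtension
      f-cong : ∀ {x y} → x ≈ᴹ y → f x ≈ᴹ f y
      f-cong {y = y} x≈y = linearExtension-LC _ (≈ᴹ-trans x≈y (proj₂ (Y-spans y)))
      f-+ : ∀ x y → f (x +ᴹ y) ≈ᴹ f x +ᴹ f y
      f-+ x y = ≈ᴹ-trans
        (linearExtension-LC _ (≈ᴹ-trans (+ᴹ-cong (proj₂ (Y-spans x)) (proj₂ (Y-spans y))) (≈ᴹ-sym (LC-+ _ _ Y))))
        (LC-+ _ _ Z)
      f-0 : f 0ᴹ ≈ᴹ 0ᴹ
      f-0 = ≈ᴹ-trans (linearExtension-LC _ (≈ᴹ-sym (LC-zeroˡ Y))) (LC-zeroˡ Z)

    linearExtension-isIsomorphism : LinearlyIndependent M Z → (∀ x → x ∈ Span M Z) →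
                                    IsAutomorphism linearExtension
    linearExtension-isIsomorphism Z-LI Z-spans = record
      { isLeftModuleMonomorphism = record
        { isLeftModuleHomomorphism = linearExtension-isHomomorphism
        ; injective = λ {x} {y} eq → ≈ᴹ-trans (proj₂ (Y-spans x))
            (≈ᴹ-trans (LC-congˡ (LC-injective Z-LI _ _ eq)) (≈ᴹ-sym (proj₂ (Y-spans y))))
        }
      ; surjective = λ y → LC (proj₁ (Z-spans y)) Y , λ z≈ →
          ≈ᴹ-trans (linearExtension-LC _ z≈) (≈ᴹ-sym (proj₂ (Z-spans y)))
      }

  module _ {Q : ℕ} (R↔Q : HasSize R.setoid Q) where

    HasSize-Span : {v : Vector Carrierᴹ n} → LinearlyIndependent M v →
                   HasSize (SubSetoid ≈ᴹ-setoid (Span M v)) (Q ^ n)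
    HasSize-Span v-LI = HasSize-resp (bijection⇒inverse proj₁′
        (λ { {_ , _ , x≈} {_ , _ , y≈} x≈y → LC-injective v-LI _ _ (≈ᴹ-trans (≈ᴹ-sym x≈) (≈ᴹ-trans x≈y y≈)) })
        (λ { {_ , _ , x≈} {_ , _ , y≈} α≋β → ≈ᴹ-trans x≈ (≈ᴹ-trans (LC-congˡ α≋β) (≈ᴹ-sym y≈)) })
        (λ α → (_ , α , ≈ᴹ-refl) , λ _ → R.refl))
      (HasSize-Vector R↔Q _)
      where
      proj₁′ : ∃ (Span M _) → Vector R.Carrier _
      proj₁′ (_ , α , _) = α

    HasSize-IsBasis : {v : Vector Carrierᴹ n} → IsBasis M v → HasSize ≈ᴹ-setoid (Q ^ n)
    HasSize-IsBasis (v-LI , v-spans) = HasSize-resp (bijection⇒inverse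
      (λ x → x , v-spans x) (λ x≈y → x≈y) (λ x≈y → x≈y) (λ (x , _) → x , ≈ᴹ-refl))
      (HasSize-Span v-LI)

    module _ {W : Pred Carrierᴹ p} {v : Vector Carrierᴹ n}
             (W↔Qⁿ : HasSize (SubSetoid ≈ᴹ-setoid W) (Q ^ n)) (v⊆W : Span M v ⊆ W) where

      private
        LC-W : Vector R.Carrier n → ∃ W
        LC-W α = LC α v , v⊆W (α , ≈ᴹ-refl)

      -- Sending coefficients to combinations is an injection between two sets of `Q ^ n` elements,
      -- hence onto. This takes the place of dimension theory.
      independent⇒spanning : LinearlyIndependent M v → W ⊆ Span M v
      independent⇒spanning v-LI {x} x∈W
        with α , eq ← injective⇒surjective (HasSize-Vector R↔Q n) W↔Qⁿ {f = LC-W}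
                        LC-congˡ (LC-injective v-LI _ _) (x , x∈W)
        = α , ≈ᴹ-sym eq

      -- The same map is now onto, hence injective, so only the zero coefficients give the zero
      -- vector.
      spanning⇒independent : W ⊆ Span M v → LinearlyIndependent M v
      spanning⇒independent W⊆ α eq =
        surjective⇒injective (HasSize-Vector R↔Q n) W↔Qⁿ {f = LC-W} LC-congˡ
          (λ (x , x∈W) → proj₁ (W⊆ x∈W) , ≈ᴹ-sym (proj₂ (W⊆ x∈W)))
          (≈ᴹ-trans eq (≈ᴹ-sym (LC-zeroˡ v)))

    Span? : (_≟_ : ∀ x y → Dec (x ≈ᴹ y)) (v : Vector Carrierᴹ n) → Decidable (Span M v)
    Span? _≟_ v x = search (HasSize-Vector R↔Q _)
      (λ α≋β x≈ → ≈ᴹ-trans x≈ (LC-congˡ α≋β)) (λ α → x ≟ LC α v)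

module CommutativeLinearCombinations {R : CommutativeRing a ℓ₁} (M : LeftModule (CommutativeRing.ring R) b ℓ₂) where
  private module R = CommutativeRing R
  open LeftModule M
  open LinearCombinations M

  LC-scale : ∀ x (α : Vector R.Carrier n) (v : Vector Carrierᴹ n) →
             LC α (λ i → x *ₗ v i) ≈ᴹ x *ₗ LC α v
  LC-scale {zero}  x α v = ≈ᴹ-sym (*ₗ-zeroʳ x)
  LC-scale {suc n} x α v = ≈ᴹ-trans (+ᴹ-cong α₀xv₀≈xα₀v₀ (LC-scale x (tail α) (tail v))) (≈ᴹ-sym (*ₗ-distribˡ x _ _))
    where
    α₀xv₀≈xα₀v₀ : α zero *ₗ (x *ₗ v zero) ≈ᴹ x *ₗ (α zero *ₗ v zero)
    α₀xv₀≈xα₀v₀ = ≈ᴹ-trans (≈ᴹ-sym (*ₗ-assoc _ _ _)) (≈ᴹ-trans (*ₗ-congʳ (R.*-comm _ _)) (*ₗ-assoc _ _ _))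

  LCᴿ-comm : (α β : Vector R.Carrier n) → LCᴿ α β R.≈ LCᴿ β α
  LCᴿ-comm {zero}  α β = R.refl
  LCᴿ-comm {suc n} α β = R.+-cong (R.*-comm _ _) (LCᴿ-comm (tail α) (tail β))

-- Counting linearly independent extensions of a family

∏-snoc : ∀ (f : ℕ → ℕ) n → product (map f (upTo (suc n))) ≡ product (map f (upTo n)) ℕ.* f n
∏-snoc f n = begin
  product (map f (upTo (suc n)))                ≡⟨ ≡.cong (product ∘ map f) (upTo-∷ʳ n) ⟨
  product (map f (upTo n List.∷ʳ n))            ≡⟨ ≡.cong product (map-++ f (upTo n) _) ⟩
  product (map f (upTo n) List.∷ʳ f n)          ≡⟨ product-++ (map f (upTo n)) _ ⟩
  product (map f (upTo n)) ℕ.* (f n ℕ.* 1)      ≡⟨ ≡.cong (product (map f (upTo n)) ℕ.*_) (*-identityʳ (f n)) ⟩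
  product (map f (upTo n)) ℕ.* f n              ∎
  where open ≡.≡-Reasoning

module Extensions (K : Field c ℓ) {Q : ℕ} (K↔Q : HasSize (Field.setoid K) Q)
                  (M : LeftModule (Field.ring K) b ℓ₂) {s : ℕ}
                  (M↔s : HasSize (LeftModule.≈ᴹ-setoid M) s) where
  private module K = Field K
  open LeftModule M
  open LinearCombinations M
  open SetoidReasoning ≈ᴹ-setoid

  LinearlyIndependent-tail : {x : Carrierᴹ} {v : Vector Carrierᴹ n} →
    LinearlyIndependent M (x ∷ v) → LinearlyIndependent M v
  LinearlyIndependent-tail xv-LI α eq i = xv-LI (K.0# ∷ α)
    (≈ᴹ-trans (+ᴹ-cong (*ₗ-zeroˡ _) eq) (+ᴹ-identityˡ 0ᴹ)) (suc i)

  LinearlyIndependent-head : {x : Carrierᴹ} {v : Vector Carrierᴹ n} →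
    LinearlyIndependent M (x ∷ v) → x ∉ Span M v
  LinearlyIndependent-head {x = x} {v} xv-LI (α , x≈) =
    K.1≉0 (LC-injective {v = x ∷ v} xv-LI (K.1# ∷ λ _ → K.0#) (K.0# ∷ α) (begin
      K.1# *ₗ x +ᴹ LC (λ _ → K.0#) v  ≈⟨ LC-δ zero (x ∷ v) ⟩
      x                               ≈⟨ x≈ ⟩
      LC α v                          ≈⟨ +ᴹ-identityˡ _ ⟨
      0ᴹ +ᴹ LC α v                    ≈⟨ +ᴹ-congʳ (*ₗ-zeroˡ x) ⟨
      K.0# *ₗ x +ᴹ LC α v             ∎) zero)

  LinearlyIndependent-∷ : {x : Carrierᴹ} {v : Vector Carrierᴹ n} →
    LinearlyIndependent M v → x ∉ Span M v → LinearlyIndependent M (x ∷ v)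
  LinearlyIndependent-∷ {x = x} {v} v-LI x∉ α eq with decidableEquality K↔Q (α zero) K.0#
  ... | yes α₀≈0 = λ
    { zero    → α₀≈0
    ; (suc i) → v-LI (tail α) (begin
        LC (tail α) v                    ≈⟨ +ᴹ-identityˡ _ ⟨
        0ᴹ +ᴹ LC (tail α) v              ≈⟨ +ᴹ-congʳ (≈ᴹ-trans (*ₗ-congʳ α₀≈0) (*ₗ-zeroˡ x)) ⟨
        α zero *ₗ x +ᴹ LC (tail α) v     ≈⟨ eq ⟩
        0ᴹ                               ∎) i }
  ... | no α₀≉0 with β , α₀β≈1 ← K.inverse (α zero) α₀≉0 =
    -- Dividing the relation by its leading coefficient solves it for `x`: below, `K.- β` times the
    -- vanishing combination is added to `x`.
    contradiction ((λ i → K.- β K.* α (suc i)) , (begin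
      x                                                        ≈⟨ +ᴹ-identityʳ x ⟨
      x +ᴹ 0ᴹ                                                  ≈⟨ +ᴹ-cong (*ₗ-identityˡ x) (*ₗ-zeroʳ _) ⟨
      K.1# *ₗ x +ᴹ K.- β *ₗ 0ᴹ                                 ≈⟨ +ᴹ-congˡ (*ₗ-congˡ eq) ⟨
      K.1# *ₗ x +ᴹ K.- β *ₗ (α zero *ₗ x +ᴹ LC (tail α) v)     ≈⟨ +ᴹ-congˡ (*ₗ-distribˡ _ _ _) ⟩
      K.1# *ₗ x +ᴹ (K.- β *ₗ (α zero *ₗ x) +ᴹ K.- β *ₗ LC (tail α) v)
        ≈⟨ +ᴹ-assoc _ _ _ ⟨
      (K.1# *ₗ x +ᴹ K.- β *ₗ (α zero *ₗ x)) +ᴹ K.- β *ₗ LC (tail α) v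
        ≈⟨ +ᴹ-congʳ (+ᴹ-congˡ (*ₗ-assoc _ _ x)) ⟨
      (K.1# *ₗ x +ᴹ (K.- β K.* α zero) *ₗ x) +ᴹ K.- β *ₗ LC (tail α) v
        ≈⟨ +ᴹ-congʳ (*ₗ-distribʳ x _ _) ⟨
      (K.1# K.+ K.- β K.* α zero) *ₗ x +ᴹ K.- β *ₗ LC (tail α) v
        ≈⟨ +ᴹ-congʳ (*ₗ-congʳ (1-βα₀≈0 β α₀β≈1)) ⟩
      K.0# *ₗ x +ᴹ K.- β *ₗ LC (tail α) v                      ≈⟨ +ᴹ-congʳ (*ₗ-zeroˡ x) ⟩
      0ᴹ +ᴹ K.- β *ₗ LC (tail α) v                             ≈⟨ +ᴹ-identityˡ _ ⟩
      K.- β *ₗ LC (tail α) v                                   ≈⟨ LC-* _ _ v ⟨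
      LC (λ i → K.- β K.* α (suc i)) v                         ∎)) x∉
    where
    open import Algebra.Properties.Ring K.ring using (-‿distribˡ-*)
    1-βα₀≈0 : ∀ β → α zero K.* β K.≈ K.1# → K.1# K.+ K.- β K.* α zero K.≈ K.0#
    1-βα₀≈0 β α₀β≈1 = K.trans (K.+-congˡ (K.trans (K.sym (-‿distribˡ-* β (α zero)))
      (K.-‿cong (K.trans (K.*-comm β _) α₀β≈1)))) (K.-‿inverseʳ K.1#)

  -- New vectors go in front of `v`, so an extension by `suc d` vectors is a head placed on an
  -- extension by `d`, and the count can proceed by recursion on `d`.
  Extension-of : Vector Carrierᴹ m → Vector Carrierᴹ n → ∀ d → Pred (Vector Carrierᴹ d) _
  Extension-of u v d x = (∀ i → x i ∈ Span M u) × LinearlyIndependent M (x ++ v)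

  Extensions : Vector Carrierᴹ m → Vector Carrierᴹ n → ℕ → Setoid _ _
  Extensions u v d = SubSetoid (≋-setoid ≈ᴹ-setoid d) (Extension-of u v d)

  HasSize-∉Span : {u : Vector Carrierᴹ m} {v : Vector Carrierᴹ n} → LinearlyIndependent M u →
    LinearlyIndependent M v → (∀ i → v i ∈ Span M u) →
    HasSize (SubSetoid (SubSetoid ≈ᴹ-setoid (Span M u)) (λ x → proj₁ x ∉ Span M v)) (Q ^ m ∸ Q ^ n)
  HasSize-∉Span {v = v} u-LI v-LI v∈ = HasSize-∁ Span-resp
    (Span? K↔Q (decidableEquality M↔s) v ∘ proj₁) (HasSize-Span K↔Q u-LI)
    (HasSize-resp (bijection⇒inverse
      (λ ((x , _) , x∈) → x , x∈) (λ x≈y → x≈y) (λ x≈y → x≈y)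
      (λ (x , x∈) → ((x , Span-least v∈ x∈) , x∈) , ≈ᴹ-refl))
    (HasSize-Span K↔Q v-LI))

  ∷-tail-independent : (x : Vector Carrierᴹ (suc m)) (v : Vector Carrierᴹ n) →
    LinearlyIndependent M (x ++ v) → LinearlyIndependent M (head x ∷ (tail x ++ v))
  ∷-tail-independent {m = m} x v = LinearlyIndependent-resp {v = x ++ v} {w = head x ∷ (tail x ++ v)} λ
    { zero → ≈ᴹ-refl ; (suc i) → ≈ᴹ-reflexive (++-suc x v i) }

  restriction : {u : Vector Carrierᴹ m} {v : Vector Carrierᴹ n} → ∀ d →
                ∃ (Extension-of u v (suc d)) → ∃ (Extension-of u v d)
  restriction {v = v} d (x , x∈ , LI) =
    tail x , x∈ ∘ suc , LinearlyIndependent-tail (∷-tail-independent x v LI)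

  -- Over `y` only the head is free, and it must avoid the span of the `d + n` independent vectors
  -- `y ++ v`. The number of choices does not depend on `y`, so fibre sizes multiply.
  HasSize-restriction-fibre : {u : Vector Carrierᴹ m} {v : Vector Carrierᴹ n} → LinearlyIndependent M u →
    (∀ i → v i ∈ Span M u) → ∀ d (y : ∃ (Extension-of u v d)) →
    HasSize (Fibre (Extensions u v (suc d)) (Extensions u v d) (restriction d) y) (Q ^ m ∸ Q ^ (d ℕ.+ n))
  HasSize-restriction-fibre {u = u} {v = v} u-LI v∈ d (y , y∈ , y-LI) =
    HasSize-resp (bijection⇒inverse to
      (λ x≋y → x≋y zero)
      (λ { {_ , x≋} {_ , y≋} x₀≈y₀ zero → x₀≈y₀
         ; {_ , x≋} {_ , y≋} x₀≈y₀ (suc i) → ≈ᴹ-trans (x≋ i) (≈ᴹ-sym (y≋ i)) })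
      (λ z → from z , ≈ᴹ-refl))
    (HasSize-∉Span u-LI y-LI (All.++⁺ (Span M u) y∈ v∈))
    where
    to : Setoid.Carrier (Fibre (Extensions u v (suc d)) (Extensions u v d) (restriction d) (y , y∈ , y-LI)) →
         ∃ λ (x : ∃ (Span M u)) → proj₁ x ∉ Span M (y ++ v)
    to ((x , x∈ , LI) , x≋y) = (x zero , x∈ zero) , λ x₀∈ →
      LinearlyIndependent-head (∷-tail-independent x v LI) (Span-cong
        (Pointwise.++⁺ _≈ᴹ_ {xs = y} {ys = tail x} (λ i → ≈ᴹ-sym (x≋y i)) (λ _ → ≈ᴹ-refl)) x₀∈)
    from : (∃ λ (x : ∃ (Span M u)) → proj₁ x ∉ Span M (y ++ v)) →
           Setoid.Carrier (Fibre (Extensions u v (suc d)) (Extensions u v d) (restriction d) (y , y∈ , y-LI))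
    from ((z , z∈) , z∉) =
      (z ∷ y , (λ { zero → z∈ ; (suc i) → y∈ i })
      , LinearlyIndependent-resp {v = z ∷ (y ++ v)} (λ i → ≈ᴹ-reflexive (≡.sym (∷-++ z y v i)))
          (LinearlyIndependent-∷ y-LI z∉))
      , λ _ → ≈ᴹ-refl

  HasSize-Extensions : {u : Vector Carrierᴹ m} {v : Vector Carrierᴹ n} → LinearlyIndependent M u →
    LinearlyIndependent M v → (∀ i → v i ∈ Span M u) → ∀ d →
    HasSize (Extensions u v d) (product (map (λ j → Q ^ m ∸ Q ^ (n ℕ.+ j)) (upTo d)))
  HasSize-Extensions u-LI v-LI v∈ zero =
    HasSize-one ([] , (λ ()) , v-LI) (λ _ _ ())
  HasSize-Extensions {m = m} {n = n} {u = u} {v = v} u-LI v-LI v∈ (suc d) =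
    -- The newest vector contributes the factor of largest index, which `∏-snoc` splits off at the
    -- end.
    ≡.subst (HasSize (Extensions u v (suc d))) (≡.sym (∏-snoc _ d))
      (HasSize-fibres {f = restriction d} (λ x≋y i → x≋y (suc i)) (HasSize-Extensions u-LI v-LI v∈ d)
        λ y → ≡.subst
          (λ k → HasSize (Fibre (Extensions u v (suc d)) (Extensions u v d) (restriction d) y) (Q ^ m ∸ Q ^ k))
          (+-comm d n)
          (HasSize-restriction-fibre u-LI v∈ d y))

-- The stabilizer of T

-- A, B and C are Y₁,…,Y_r, then Y_{r+1},…,Y_{k-1}, then Y_k,…,Y_m; here r is one less than in the paper.
module SubspaceStabilizer
  (F : Field a ℓ₁) (K : Field c ℓ) {ι : Field.Carrier F → Field.Carrier K}
  (ι-homo : IsRingHomomorphism (Field.rawRing F) (Field.rawRing K) ι)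
  (V : LeftModule (Field.ring K) b ℓ₂)
  {r d e : ℕ} (u : Vector (Field.Carrier K) (suc r))
  (A : Vector (LeftModule.Carrierᴹ V) (suc r))
  (B : Vector (LeftModule.Carrierᴹ V) d)
  (C : Vector (LeftModule.Carrierᴹ V) e)
  (1,u-independent : LinearlyIndependent (Extension.K-over-F F K ι-homo) (Field.1# K ∷ u))
  (ABC-basis : IsBasis V ((A ++ B) ++ C))
  {q Q : ℕ} (F↔q : HasSize (Field.setoid F) q) (K↔Q : HasSize (Field.setoid K) Q)
  where

  open Extension F K ι-homo
  private
    module F = Field F
    module K = Field K
    module ι = IsRingHomomorphism ι-homo
    V/F = restrictScalars {F = F.ring} {K = K.ring} ι-homo V
    module VK = LinearCombinations V
    module VF = LinearCombinations V/F
    module KK = LinearCombinations (leftModule {R = K.ring})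
    module KF = LinearCombinations K-over-F
    module FFc = CommutativeLinearCombinations {R = F.commutativeRing} V/F
    module KKc = CommutativeLinearCombinations {R = K.commutativeRing} (leftModule {R = K.ring})
  open LeftModule V

  ε : Vector K.Carrier (suc (suc r))
  ε = K.1# ∷ u

  t : Vector Carrierᴹ (suc (suc r))
  t = (-ᴹ VK.LC u A) ∷ A

  AB : Vector Carrierᴹ (suc r ℕ.+ d)
  AB = A ++ B

  ABC : Vector Carrierᴹ (suc r ℕ.+ d ℕ.+ e)
  ABC = AB ++ C

  U : Pred K.Carrier _
  U = ⟨1, u ⟩

  -- This is T with its last generator negated and the generators reordered so that those entering
  -- the relation come last.
  T′ : Pred Carrierᴹ _
  T′ = Span V/F (B ++ t)

  AB-independent : LinearlyIndependent V AB
  AB-independent = VK.LinearlyIndependent-++⁻ˡ AB C (proj₁ ABC-basis)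

  -- The relation between the generators and its consequences

  relation : VK.LC ε t ≈ᴹ 0ᴹ
  relation = ≈ᴹ-trans (+ᴹ-congʳ (*ₗ-identityˡ _)) (-ᴹ‿inverseˡ _)

  open SetoidReasoning ≈ᴹ-setoid

  -- Subtracting `x zero` times `relation` removes `t zero`, as `ε zero` is 1. What remains is a
  -- K-relation on the independent family `AB`, so all its coefficients vanish.
  relation-unique : (x : Vector K.Carrier (suc (suc r))) (y : Vector K.Carrier d) →
    VK.LC x t +ᴹ VK.LC y B ≈ᴹ 0ᴹ → (∀ j → x j K.≈ x zero K.* ε j) × (∀ j → y j K.≈ K.0#)
  relation-unique x y eq = (λ
    { zero    → K.sym (K.*-identityʳ _)
    ; (suc j) → x≈ (proj₁ vanish j) }) , proj₂ vanish
    where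
    open import Algebra.Properties.Ring K.ring using (-‿distribˡ-*; x∙y⁻¹≈ε⇒x≈y)
    x′ : Vector K.Carrier (suc (suc r))
    x′ j = x j K.+ K.- x zero K.* ε j
    x≈ : ∀ {x y z} → x K.+ K.- y K.* z K.≈ K.0# → x K.≈ y K.* z
    x≈ {x} {y} {z} x-yz≈0 = x∙y⁻¹≈ε⇒x≈y x (y K.* z)
      (K.trans (K.+-congˡ (-‿distribˡ-* y z)) x-yz≈0)
    x′₀≈0 : x′ zero K.≈ K.0#
    x′₀≈0 = K.trans (K.+-congˡ (K.*-identityʳ _)) (K.-‿inverseʳ _)
    vanish : (∀ j → x′ (suc j) K.≈ K.0#) × (∀ j → y j K.≈ K.0#)
    vanish = VK.independent-++ AB-independent (tail x′) y (begin
      VK.LC (tail x′) A +ᴹ VK.LC y B                          ≈⟨ +ᴹ-congʳ (+ᴹ-identityˡ _) ⟨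
      0ᴹ +ᴹ VK.LC (tail x′) A +ᴹ VK.LC y B
        ≈⟨ +ᴹ-congʳ (+ᴹ-congʳ (≈ᴹ-trans (*ₗ-congʳ x′₀≈0) (*ₗ-zeroˡ (t zero)))) ⟨
      VK.LC x′ t +ᴹ VK.LC y B                                 ≈⟨ +ᴹ-congʳ (VK.LC-+ x (λ j → K.- x zero K.* ε j) t) ⟩
      VK.LC x t +ᴹ VK.LC (λ j → K.- x zero K.* ε j) t +ᴹ VK.LC y B
        ≈⟨ +ᴹ-congʳ (+ᴹ-congˡ (≈ᴹ-trans (VK.LC-* _ ε t) (≈ᴹ-trans (*ₗ-congˡ relation) (*ₗ-zeroʳ _)))) ⟩
      VK.LC x t +ᴹ 0ᴹ +ᴹ VK.LC y B                            ≈⟨ +ᴹ-congʳ (+ᴹ-identityʳ _) ⟩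
      VK.LC x t +ᴹ VK.LC y B                                  ≈⟨ eq ⟩
      0ᴹ                                                      ∎)

  -- Both sides are F-combinations of `ε` with a single term, so their coordinates agree. Equal
  -- indices give injectivity of `ι`; distinct ones force both scalars to vanish.
  ι*-injective : ∀ x y i j → ι x K.* ε i K.≈ ι y K.* ε j → ∀ k → x F.* KF.δ i k F.≈ y F.* KF.δ j k
  ι*-injective x y i j eq = KF.LC-injective {v = ε} 1,u-independent _ _
    (K.trans (lemma x i) (K.trans eq (K.sym (lemma y j))))
    where
    lemma : ∀ x i → KF.LC (λ k → x F.* KF.δ i k) ε K.≈ ι x K.* ε i
    lemma x i = K.trans (KF.LC-* x (KF.δ i) ε) (K.*-congˡ (KF.LC-δ i ε))

  ι-injective : ∀ x → ι x K.≈ K.0# → x F.≈ F.0#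
  ι-injective x ιx≈0 = F.trans (F.sym (F.*-identityʳ x)) (F.trans
    (ι*-injective x F.0# zero zero (K.*-congʳ (K.trans ιx≈0 (K.sym ι.0#-homo))) zero)
    (F.zeroˡ _))

  Bt-independent : LinearlyIndependent V/F (B ++ t)
  Bt-independent α eq = ↑-cases (λ i → α i F.≈ F.0#) (λ i → ι-injective _ (proj₂ rel i)) β≈0
    where
    β : Vector F.Carrier (suc (suc r))
    β = drop d α
    rel : (∀ j → ι (β j) K.≈ ι (β zero) K.* ε j) × (∀ j → ι (take d α j) K.≈ K.0#)
    rel = relation-unique (ι ∘ β) (ι ∘ take d α)
      (≈ᴹ-trans (+ᴹ-comm _ _) (≈ᴹ-trans (≈ᴹ-sym (VF.LC-++ α B t)) eq))
    -- The relation gives β₁ = β₀u₁ with β₀ and β₁ in F, so independence of 1 and u₁ forces β₀ = 0.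
    -- The index `suc zero` exists because the family `u` is nonempty.
    β₀≈0 : β zero F.≈ F.0#
    β₀≈0 = F.sym (F.trans (F.sym (F.zeroʳ _)) (F.trans
      (ι*-injective (β (suc zero)) (β zero) zero (suc zero)
        (K.trans (K.*-identityʳ _) (proj₁ rel (suc zero))) (suc zero))
      (F.*-identityʳ _)))
    β≈0 : ∀ j → β j F.≈ F.0#
    β≈0 j = ι-injective _ (K.trans (proj₁ rel j)
      (K.trans (K.*-congʳ (K.trans (ι.⟦⟧-cong β₀≈0) ι.0#-homo)) (K.zeroˡ _)))

  t-independent : LinearlyIndependent V/F t
  t-independent = VF.LinearlyIndependent-++⁻ʳ B t Bt-independent

  -- Matrices linking a map on t with a multiplier of ε

  Matrix : Set a
  Matrix = Fin (suc (suc r)) → Vector F.Carrier (suc (suc r))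

  column : Matrix → Fin (suc (suc r)) → Vector F.Carrier (suc (suc r))
  column X j i = X i j

  -- One matrix is read twice: its rows are the coordinates of the `g (t i)`, its columns those of
  -- the `h * ε j`. The second condition is εX = hε.
  record Matches (g : Carrierᴹ → Carrierᴹ) (h : K.Carrier) (X : Matrix) : Set (ℓ ⊔ ℓ₂) where
    constructor _,_
    field
      on-t : ∀ i → g (t i) ≈ᴹ VF.LC (X i) t
      on-ε : ∀ j → h K.* ε j K.≈ KF.LC (column X j) ε
  open Matches

  IsEndomorphism : (Carrierᴹ → Carrierᴹ) → Set _
  IsEndomorphism = IsLeftModuleHomomorphism rawLeftModule rawLeftModule

  image-relation : {g : Carrierᴹ → Carrierᴹ} → IsEndomorphism g → VK.LC ε (g ∘ t) ≈ᴹ 0ᴹ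
  image-relation g-homo = ≈ᴹ-trans (≈ᴹ-sym (VK.LC-map g-homo ε t))
    (≈ᴹ-trans (IsLeftModuleHomomorphism.⟦⟧-cong g-homo relation) (IsLeftModuleHomomorphism.0ᴹ-homo g-homo))

  -- Expanding each `g (t i)` over `B ++ t` with F-coordinates `N i` turns the image of the relation
  -- into a K-relation with coefficients εN. By `relation-unique` its part on `t` is a multiple of
  -- ε, and `h` is that multiple, read off at `t zero`.
  matching : {g : Carrierᴹ → Carrierᴹ} → IsEndomorphism g → (∀ i → g (t i) ∈ T′) → ∃ λ h → ∃ (Matches g h)
  matching {g} g-homo gt∈T′ = h , X , (gt≈ , hε≈)
    where
    N : Fin (suc (suc r)) → Vector F.Carrier (d ℕ.+ suc (suc r))
    N i = proj₁ (gt∈T′ i)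
    X : Matrix
    X i = drop d (N i)
    x : Vector K.Carrier (d ℕ.+ suc (suc r))
    x k = KK.LCᴿ ε (λ i → ι (N i k))
    x≈ : ∀ k → x k K.≈ KF.LC (λ i → N i k) ε
    x≈ k = KKc.LCᴿ-comm ε (λ i → ι (N i k))
    h : K.Carrier
    h = x (d ↑ʳ zero)
    rel : (∀ j → x (d ↑ʳ j) K.≈ h K.* ε j) × (∀ j → x (j ↑ˡ suc (suc r)) K.≈ K.0#)
    rel = relation-unique (drop d x) (take d x) (begin
      VK.LC (drop d x) t +ᴹ VK.LC (take d x) B             ≈⟨ +ᴹ-comm _ _ ⟩
      VK.LC (take d x) B +ᴹ VK.LC (drop d x) t             ≈⟨ VK.LC-++ x B t ⟨
      VK.LC x (B ++ t)                                     ≈⟨ VK.LC-LC ε (λ i k → ι (N i k)) (B ++ t) ⟨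
      VK.LC ε (λ i → VF.LC (N i) (B ++ t))                 ≈⟨ VK.LC-congʳ {α = ε} (proj₂ ∘ gt∈T′) ⟨
      VK.LC ε (g ∘ t)                                      ≈⟨ image-relation g-homo ⟩
      0ᴹ                                                   ∎)
    -- The coefficient at `B j` is Σᵢ εᵢ N i j = 0 with all `N i j` in F, so independence of ε over
    -- F kills each entry.
    N≈0 : ∀ i j → N i (j ↑ˡ suc (suc r)) F.≈ F.0#
    N≈0 i j = 1,u-independent (λ i → N i (j ↑ˡ suc (suc r)))
      (K.trans (K.sym (x≈ (j ↑ˡ suc (suc r)))) (proj₂ rel j)) i
    gt≈ : ∀ i → g (t i) ≈ᴹ VF.LC (X i) t
    gt≈ i = begin
      g (t i)                                        ≈⟨ proj₂ (gt∈T′ i) ⟩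
      VF.LC (N i) (B ++ t)                           ≈⟨ VF.LC-++ (N i) B t ⟩
      VF.LC (take d (N i)) B +ᴹ VF.LC (X i) t        ≈⟨ +ᴹ-congʳ (VF.LC-congˡ (N≈0 i)) ⟩
      VF.LC (λ _ → F.0#) B +ᴹ VF.LC (X i) t          ≈⟨ +ᴹ-congʳ (VF.LC-zeroˡ B) ⟩
      0ᴹ +ᴹ VF.LC (X i) t                            ≈⟨ +ᴹ-identityˡ _ ⟩
      VF.LC (X i) t                                  ∎
    hε≈ : ∀ j → h K.* ε j K.≈ KF.LC (column X j) ε
    hε≈ j = K.trans (K.sym (proj₁ rel j)) (x≈ (d ↑ʳ j))

  module _ {g g′ : Carrierᴹ → Carrierᴹ} {h h′ : K.Carrier} {X X′ : Matrix}
           (g~h : Matches g h X) (g′~h′ : Matches g′ h′ X′) where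

    -- Independence of `t` recovers the rows of the matrix, and its column at `zero` gives back `h`,
    -- because `ε zero` is 1.
    multiplier-unique : (∀ i → g (t i) ≈ᴹ g′ (t i)) → h K.≈ h′
    multiplier-unique gt≈g′t = K.trans (K.sym (K.*-identityʳ h)) (K.trans (on-ε g~h zero)
      (K.trans (KF.LC-congˡ {v = ε} λ i → VF.LC-injective {v = t} t-independent (X i) (X′ i)
        (≈ᴹ-trans (≈ᴹ-sym (on-t g~h i)) (≈ᴹ-trans (gt≈g′t i) (on-t g′~h′ i))) zero)
      (K.trans (K.sym (on-ε g′~h′ zero)) (K.*-identityʳ h′))))

    -- Independence of `ε` recovers the columns of the matrix from `h`, and its rows give the values
    -- on `t`.
    multiplier-determines : h K.≈ h′ → ∀ i → g (t i) ≈ᴹ g′ (t i)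
    multiplier-determines h≈h′ i = ≈ᴹ-trans (on-t g~h i) (≈ᴹ-trans
      (VF.LC-congˡ {v = t} λ j → KF.LC-injective {v = ε} 1,u-independent (column X j) (column X′ j)
        (K.trans (K.sym (on-ε g~h j)) (K.trans (K.*-congʳ h≈h′) (on-ε g′~h′ j))) i)
      (≈ᴹ-sym (on-t g′~h′ i)))

  -- Only hU ⊆ U, tested on generators: this form is decidable by finite search, and equality
  -- follows from `IsMultiplier-inverse`.
  IsMultiplier : Pred K.Carrier _
  IsMultiplier h = ¬ (h K.≈ K.0#) × (∀ j → h K.* ε j ∈ U)

  -- If `h` were 0, independence of ε would make all columns of `X` zero, so `g` would kill
  -- `t zero`, which is nonzero.
  multiplier-nonzero : {g : Carrierᴹ → Carrierᴹ} {h : K.Carrier} {X : Matrix} →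
    IsEndomorphism g → (∀ {x y} → g x ≈ᴹ g y → x ≈ᴹ y) → Matches g h X → ¬ (h K.≈ K.0#)
  multiplier-nonzero {g} {h} {X} g-homo g-injective (gt≈ , hε≈) h≈0 =
    F.1≉0 (VF.LC-injective {v = t} t-independent (VF.δ zero) (λ _ → F.0#) (begin
      VF.LC (VF.δ zero) t       ≈⟨ VF.LC-δ zero t ⟩
      t zero                    ≈⟨ t₀≈0 ⟩
      0ᴹ                        ≈⟨ VF.LC-zeroˡ t ⟨
      VF.LC (λ _ → F.0#) t      ∎) zero)
    where
    X≈0 : ∀ i j → X i j F.≈ F.0#
    X≈0 i j = 1,u-independent (column X j)
      (K.trans (K.sym (hε≈ j)) (K.trans (K.*-congʳ h≈0) (K.zeroˡ _))) i
    t₀≈0 : t zero ≈ᴹ 0ᴹ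
    t₀≈0 = g-injective (≈ᴹ-trans (gt≈ zero) (≈ᴹ-trans (VF.LC-congˡ {v = t} (X≈0 zero))
      (≈ᴹ-trans (VF.LC-zeroˡ t) (≈ᴹ-sym (IsLeftModuleHomomorphism.0ᴹ-homo g-homo)))))

  U↔ : HasSize (SubSetoid K.setoid U) (q ^ suc (suc r))
  U↔ = KF.HasSize-Span F↔q {v = ε} 1,u-independent

  multiples∈U : ∀ {h} → (∀ j → h K.* ε j ∈ U) → ∀ {x} → x ∈ U → h K.* x ∈ U
  multiples∈U {h} hε∈U (α , x≈) = KF.Span-resp {v = ε}
    (K.trans (KKc.LC-scale h (ι ∘ α) ε) (K.*-congˡ (K.sym x≈))) (KF.Span-LC α {v = ε} hε∈U)

  -- The family hε is independent, lies in `U` and has as many members as ε, so by counting it spans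
  -- `U`. Writing `ε j` over it and multiplying by `k` gives the coordinates.
  IsMultiplier-inverse : ∀ {h k} → IsMultiplier h → h K.* k K.≈ K.1# → ∀ j → k K.* ε j ∈ U
  IsMultiplier-inverse {h} {k} (h≉0 , hε∈U) hk≈1 j =
    α , K.trans (K.*-congˡ (K.trans (proj₂ ε∈) (KKc.LC-scale h (ι ∘ α) ε))) (cancel _)
    where
    cancel : ∀ x → k K.* (h K.* x) K.≈ x
    cancel x = K.trans (K.sym (K.*-assoc k h x))
      (K.trans (K.*-congʳ (K.trans (K.*-comm k h) hk≈1)) (K.*-identityˡ x))
    hε-independent : LinearlyIndependent K-over-F (λ j → h K.* ε j)
    hε-independent α eq = 1,u-independent α (K.trans (K.sym (cancel _))
      (K.trans (K.*-congˡ (K.trans (K.sym (KKc.LC-scale h (ι ∘ α) ε)) eq)) (K.zeroʳ k)))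
    ε∈ : ε j ∈ Span K-over-F (λ j → h K.* ε j)
    ε∈ = KF.independent⇒spanning F↔q {W = U} {v = λ j → h K.* ε j} U↔
           (KF.Span-least {v = ε} hε∈U) hε-independent (KF.Span-generator ε j)
    α = proj₁ ε∈

  Multipliers : Setoid _ _
  Multipliers = SubSetoid K.setoid IsMultiplier

  IsMultiplier-resp : ∀ {h k} → h K.≈ k → IsMultiplier h → IsMultiplier k
  IsMultiplier-resp h≈k (h≉0 , hε∈U) =
    (λ k≈0 → h≉0 (K.trans h≈k k≈0)) , λ j → KF.Span-resp {v = ε} (K.*-congʳ h≈k) (hε∈U j)

  IsMultiplier? : Decidable IsMultiplier
  IsMultiplier? h = ¬? (decidableEquality K↔Q h K.0#) ×-dec
    all? (λ j → KF.Span? F↔q (decidableEquality K↔Q) ε (h K.* ε j))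

  HasSize-Multipliers : ∃ (HasSize Multipliers)
  HasSize-Multipliers = HasSize-decidable K↔Q IsMultiplier-resp IsMultiplier?

  Singer↔Multipliers : Inverse (Singer-stabilizer K U) Multipliers
  Singer↔Multipliers = bijection⇒inverse
    (λ ((h , h≉0) , hU≐U) → h , h≉0 , λ j → proj₁ hU≐U (ε j , KF.Span-generator ε j , K.refl))
    -- Elements of the Singer cycle are compared as maps; evaluation at 1 recovers the scalar.
    (λ h≈k → K.trans (K.sym (K.*-identityʳ _)) (K.trans (h≈k K.1#) (K.*-identityʳ _)))
    (λ h≈k x → K.*-congʳ h≈k)
    (λ (h , h∈) → stabilizes h h∈ , K.refl)
    where
    stabilizes : ∀ h → IsMultiplier h → Setoid.Carrier (Singer-stabilizer K U)
    stabilizes h h∈@(h≉0 , hε∈U) with k , hk≈1 ← K.inverse h h≉0 =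
      (h , h≉0)
      , (λ (x , x∈U , hx≈y) → KF.Span-resp {v = ε} hx≈y (multiples∈U hε∈U x∈U))
      , (λ {y} y∈U → k K.* y , multiples∈U (IsMultiplier-inverse h∈ hk≈1) y∈U
                   , K.trans (K.sym (K.*-assoc h k y)) (K.trans (K.*-congʳ hk≈1) (K.*-identityˡ y)))

  -- With εX = hε and εN = h⁻¹ε one gets ε(NX) = ε, whence NX = 1.
  inverse-matching : ∀ {h} → IsMultiplier h → (X : Matrix) → (∀ j → h K.* ε j K.≈ KF.LC (column X j) ε) →
    ∃ λ (N : Matrix) → ∀ l → t l ≈ᴹ VF.LC (N l) (λ i → VF.LC (X i) t)
  inverse-matching {h} h∈@(h≉0 , _) X hε≈ with k , hk≈1 ← K.inverse h h≉0 =
    N , λ l → begin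
      t l                                            ≈⟨ VF.LC-δ l t ⟨
      VF.LC (VF.δ l) t
        ≈⟨ VF.LC-congˡ {v = t} (λ j → F.trans (FFc.LCᴿ-comm (N l) (column X j)) (NX≈1 j l)) ⟨
      VF.LC (λ j → VF.LCᴿ (N l) (column X j)) t      ≈⟨ VF.LC-LC (N l) X t ⟨
      VF.LC (N l) (λ i → VF.LC (X i) t)              ∎
    where
    kε∈U : ∀ j → k K.* ε j ∈ U
    kε∈U = IsMultiplier-inverse h∈ hk≈1
    N : Matrix
    N l i = proj₁ (kε∈U i) l
    NX≈1 : ∀ j l → VF.LCᴿ (column X j) (N l) F.≈ VF.δ l j
    NX≈1 j l = F.trans (KF.LC-injective {v = ε} 1,u-independent (λ l → VF.LCᴿ (column X j) (N l)) (KF.δ j)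
      (K.trans (K.sym (KF.LC-LC (column X j) (λ i l → N l i) ε))
      (K.trans (KF.LC-congʳ {α = column X j} (λ i → K.sym (proj₂ (kε∈U i))))
      (K.trans (KKc.LC-scale k (ι ∘ column X j) ε)
      (K.trans (K.*-congˡ (K.sym (hε≈ j)))
      (K.trans (K.sym (K.*-assoc k h (ε j)))
      (K.trans (K.*-congʳ (K.trans (K.*-comm k h) hk≈1))
      (K.trans (K.*-identityˡ _) (K.sym (KF.LC-δ j ε))))))))) l)
      (F.reflexive (KF.δ-sym j l))

  V↔ : HasSize ≈ᴹ-setoid (Q ^ (suc r ℕ.+ d ℕ.+ e))
  V↔ = VK.HasSize-IsBasis K↔Q {v = ABC} ABC-basis

  T′↔ : HasSize (SubSetoid ≈ᴹ-setoid T′) (q ^ (d ℕ.+ suc (suc r)))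
  T′↔ = VF.HasSize-Span F↔q Bt-independent

  -- The size of `V` supplies decidable equality of vectors, so its expression as a power of `Q`
  -- serves over `F` as well.
  module EF = Extensions F F↔q V/F V↔
  module EK = Extensions K K↔Q V V↔

  -- This makes the K-span of `AB` invariant under the stabilizer, so that the images of `C` can be
  -- counted modulo it.
  T′⊆Span-AB : T′ ⊆ Span V AB
  T′⊆Span-AB (α , x≈) = VK.Span-++-least {x = B} {y = t} {v = AB}
    (VK.Span-++ʳ A B ∘ VK.Span-generator B)
    (λ { zero    → VK.Span--ᴹ {v = AB} (VK.Span-++ˡ A B (u , ≈ᴹ-refl))
       ; (suc i) → VK.Span-++ˡ A B (VK.Span-generator A i) })
    (ι ∘ α , x≈)

  B∈T′ : ∀ i → B i ∈ T′
  B∈T′ = VF.Span-++ˡ B t ∘ VF.Span-generator B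

  t∈T′ : ∀ i → t i ∈ T′
  t∈T′ = VF.Span-++ʳ B t ∘ VF.Span-generator t

  AB∈Span-ABC : ∀ i → AB i ∈ Span V ABC
  AB∈Span-ABC i = proj₂ ABC-basis (AB i)

  -- From stabilizer elements to parameters

  G-T′ : Setoid _ _
  G-T′ = GL-stabilizer V T′

  private module G = Setoid G-T′

  ⟦_⟧ : G.Carrier → Carrierᴹ → Carrierᴹ
  ⟦ (f , _) , _ ⟧ = f

  module _ (g : G.Carrier) where
    private
      f = ⟦ g ⟧
      open IsLeftModuleIsomorphism (proj₂ (proj₁ g))
        using (isLeftModuleHomomorphism; injective; surjective; ⟦⟧-cong)

    preserves-T′ : ∀ {x} → x ∈ T′ → f x ∈ T′
    preserves-T′ x∈T′ = proj₁ (proj₂ g) (_ , x∈T′ , ≈ᴹ-refl)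

    stabilizer-matching : ∃ λ h → ∃ (Matches f h)
    stabilizer-matching = matching isLeftModuleHomomorphism (preserves-T′ ∘ t∈T′)

    multiplier : K.Carrier
    multiplier = proj₁ stabilizer-matching

    multiplier-matches : Matches f multiplier (proj₁ (proj₂ stabilizer-matching))
    multiplier-matches = proj₂ (proj₂ stabilizer-matching)

    multiplier-IsMultiplier : IsMultiplier multiplier
    multiplier-IsMultiplier =
      multiplier-nonzero isLeftModuleHomomorphism injective multiplier-matches ,
      λ j → column (proj₁ (proj₂ stabilizer-matching)) j , on-ε multiplier-matches j

    -- Since `f` maps T′ onto itself and sends `t` into the F-span of `t`, the family `(f ∘ B) ++ t`
    -- spans T′; having the right length, it is independent.
    image-B : EF.Extension-of (B ++ t) t d (f ∘ B)
    image-B = preserves-T′ ∘ B∈T′ , VF.spanning⇒independent F↔q {W = T′} {v = (f ∘ B) ++ t} T′↔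
      (VF.Span-++-least {x = f ∘ B} {y = t} (preserves-T′ ∘ B∈T′) t∈T′) spans
      where
      generators : ∀ i → f ((B ++ t) i) ∈ Span V/F ((f ∘ B) ++ t)
      generators = All.++⁺ (λ x → f x ∈ Span V/F ((f ∘ B) ++ t)) {xs = B} {ys = t}
        (VF.Span-++ˡ (f ∘ B) t ∘ VF.Span-generator (f ∘ B))
        (λ i → VF.Span-++ʳ (f ∘ B) t (proj₁ (proj₂ stabilizer-matching) i , on-t multiplier-matches i))
      spans : T′ ⊆ Span V/F ((f ∘ B) ++ t)
      spans x∈T′ with w , (α , w≈) , fw≈x ← proj₂ (proj₂ g) x∈T′ = VF.Span-resp
        (≈ᴹ-trans (≈ᴹ-sym (VK.LC-map isLeftModuleHomomorphism (ι ∘ α) (B ++ t)))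
          (≈ᴹ-trans (⟦⟧-cong (≈ᴹ-sym w≈)) fw≈x))
        (VF.Span-LC α {x = f ∘ (B ++ t)} generators)

    -- Surjectivity of `f` and invariance of the K-span of `AB` make `(f ∘ C) ++ AB` span `V`, and
    -- counting again gives independence.
    image-C : EK.Extension-of ABC AB e (f ∘ C)
    image-C = (λ i → proj₂ ABC-basis _) , VK.spanning⇒independent K↔Q {W = Span V ABC} {v = (f ∘ C) ++ AB}
      (≡.subst (HasSize _) (≡.cong (Q ^_) (+-comm (suc r ℕ.+ d) e))
        (VK.HasSize-Span K↔Q {v = ABC} (proj₁ ABC-basis)))
      (λ _ → proj₂ ABC-basis _) (λ {x} _ → spans x)
      where
      generators : ∀ i → f (ABC i) ∈ Span V ((f ∘ C) ++ AB)
      generators = All.++⁺ (λ x → f x ∈ Span V ((f ∘ C) ++ AB)) {xs = AB} {ys = C}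
        (All.++⁺ (λ x → f x ∈ Span V ((f ∘ C) ++ AB)) {xs = A} {ys = B}
          (VK.Span-++ʳ (f ∘ C) AB ∘ T′⊆Span-AB ∘ preserves-T′ ∘ t∈T′ ∘ suc)
          (VK.Span-++ʳ (f ∘ C) AB ∘ T′⊆Span-AB ∘ preserves-T′ ∘ B∈T′))
        (VK.Span-++ˡ (f ∘ C) AB ∘ VK.Span-generator (f ∘ C))
      spans : ∀ x → x ∈ Span V ((f ∘ C) ++ AB)
      spans x with w , fw≈x ← surjective x | α , w≈ ← proj₂ ABC-basis (proj₁ (surjective x)) =
        VK.Span-resp (≈ᴹ-trans (≈ᴹ-sym (VK.LC-map isLeftModuleHomomorphism α ABC)) (fw≈x (≈ᴹ-sym w≈)))
          (VK.Span-LC α {x = f ∘ ABC} generators)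

  Parameters : Setoid _ _
  Parameters = Multipliers ×ₛ (EF.Extensions (B ++ t) t d ×ₛ EK.Extensions ABC AB e)

  parameters : G.Carrier → Setoid.Carrier Parameters
  parameters g = (multiplier g , multiplier-IsMultiplier g) , (⟦ g ⟧ ∘ B , image-B g) , (⟦ g ⟧ ∘ C , image-C g)

  parameters-cong : ∀ {g g′} → g G.≈ g′ → Setoid._≈_ Parameters (parameters g) (parameters g′)
  parameters-cong {g} {g′} g≈g′ =
    multiplier-unique (multiplier-matches g) (multiplier-matches g′) (g≈g′ ∘ t) , g≈g′ ∘ B , g≈g′ ∘ C

  parameters-injective : ∀ {g g′} → Setoid._≈_ Parameters (parameters g) (parameters g′) → g G.≈ g′
  parameters-injective {g} {g′} (h≈h′ , B≈B′ , C≈C′) x with α , x≈ ← proj₂ ABC-basis x = begin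
    f x                     ≈⟨ ⟦⟧-cong (proj₂ (proj₁ g)) x≈ ⟩
    f (VK.LC α ABC)         ≈⟨ VK.LC-map (isLeftModuleHomomorphism (proj₂ (proj₁ g))) α ABC ⟩
    VK.LC α (f ∘ ABC)       ≈⟨ VK.LC-congʳ {α = α} fABC≈f′ABC ⟩
    VK.LC α (f′ ∘ ABC)      ≈⟨ VK.LC-map (isLeftModuleHomomorphism (proj₂ (proj₁ g′))) α ABC ⟨
    f′ (VK.LC α ABC)        ≈⟨ ⟦⟧-cong (proj₂ (proj₁ g′)) x≈ ⟨
    f′ x                    ∎
    where
    open IsLeftModuleIsomorphism
    f f′ : Carrierᴹ → Carrierᴹ
    f = ⟦ g ⟧
    f′ = ⟦ g′ ⟧
    fABC≈f′ABC : ∀ i → f (ABC i) ≈ᴹ f′ (ABC i)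
    fABC≈f′ABC = All.++⁺ (λ x → f x ≈ᴹ f′ x) {xs = AB} {ys = C}
      (All.++⁺ (λ x → f x ≈ᴹ f′ x) {xs = A} {ys = B}
        -- `A` is the tail of `t`, so equal multipliers already give equal values on it.
        (multiplier-determines (multiplier-matches g) (multiplier-matches g′) h≈h′ ∘ suc) B≈B′) C≈C′

  -- From parameters to stabilizer elements

  module _ {h : K.Carrier} (h∈ : IsMultiplier h)
           {x : Vector Carrierᴹ d} (x-extends : EF.Extension-of (B ++ t) t d x)
           {z : Vector Carrierᴹ e} (z-extends : EK.Extension-of ABC AB e z) where
    private
      X : Matrix
      X i j = proj₁ (proj₂ h∈ j) i

      Xt : Vector Carrierᴹ (suc (suc r))
      Xt i = VF.LC (X i) t

      -- Only the tail of `Xt` is prescribed, since `t zero` lies in the K-span of `A`. That its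
      -- image is the remaining row is proved in `f-t`.
      Z : Vector Carrierᴹ (suc r ℕ.+ d ℕ.+ e)
      Z = (tail Xt ++ x) ++ z

      f : Carrierᴹ → Carrierᴹ
      f = VK.linearExtension {Y = ABC} (proj₁ ABC-basis) (proj₂ ABC-basis) Z

      f-homo : IsEndomorphism f
      f-homo = VK.linearExtension-isHomomorphism {Y = ABC} (proj₁ ABC-basis) (proj₂ ABC-basis) Z

      f-cong : ∀ {x y} → x ≈ᴹ y → f x ≈ᴹ f y
      f-cong = IsLeftModuleHomomorphism.⟦⟧-cong f-homo

      f-ABC : (∀ i → f (AB i) ≈ᴹ (tail Xt ++ x) i) × (∀ i → f (C i) ≈ᴹ z i)
      f-ABC = Pointwise.++⁻ (λ y w → f y ≈ᴹ w) AB (tail Xt ++ x) {C} {z}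
        (VK.linearExtension-generator {Y = ABC} (proj₁ ABC-basis) (proj₂ ABC-basis) Z)

      f-AB : (∀ i → f (A i) ≈ᴹ Xt (suc i)) × (∀ i → f (B i) ≈ᴹ x i)
      f-AB = Pointwise.++⁻ (λ y w → f y ≈ᴹ w) A (tail Xt) {B} {x} (proj₁ f-ABC)

      hε≈ : ∀ j → h K.* ε j K.≈ KF.LC (column X j) ε
      hε≈ j = proj₂ (proj₂ h∈ j)

      -- By associativity Σ εᵢ(Xt)ᵢ = Σ (εX)ⱼtⱼ, and εX = hε reduces this to `h` times the original
      -- relation.
      Xt-relation : VK.LC ε Xt ≈ᴹ 0ᴹ
      Xt-relation = begin
        VK.LC ε Xt                                    ≈⟨ VK.LC-LC ε (λ i j → ι (X i j)) t ⟩
        VK.LC (λ j → KK.LCᴿ ε (ι ∘ column X j)) t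
          ≈⟨ VK.LC-congˡ {v = t} (λ j →
               K.trans (KKc.LCᴿ-comm ε (ι ∘ column X j)) (K.sym (hε≈ j))) ⟩
        VK.LC (λ j → h K.* ε j) t                     ≈⟨ VK.LC-* h ε t ⟩
        h *ₗ VK.LC ε t                                ≈⟨ *ₗ-congˡ relation ⟩
        h *ₗ 0ᴹ                                       ≈⟨ *ₗ-zeroʳ h ⟩
        0ᴹ                                            ∎

      -- The families `f ∘ t` and `Xt` satisfy the same relation with coefficients ε and agree after
      -- index `zero`; as `ε zero` is 1, they agree there too.
      f-t : ∀ i → f (t i) ≈ᴹ Xt i
      f-t (suc i) = proj₁ f-AB i
      f-t zero    = begin
        f (t zero)               ≈⟨ *ₗ-identityˡ _ ⟨
        K.1# *ₗ f (t zero)       ≈⟨ +ᴹ-cancelʳ (VK.LC u (f ∘ A)) _ _ (begin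
          VK.LC ε (f ∘ t)                          ≈⟨ image-relation f-homo ⟩
          0ᴹ                                       ≈⟨ Xt-relation ⟨
          VK.LC ε Xt                               ≈⟨ +ᴹ-congˡ (VK.LC-congʳ {α = u} (proj₁ f-AB)) ⟨
          K.1# *ₗ Xt zero +ᴹ VK.LC u (f ∘ A)       ∎) ⟩
        K.1# *ₗ Xt zero          ≈⟨ *ₗ-identityˡ _ ⟩
        Xt zero                  ∎
        where open import Algebra.Properties.AbelianGroup +ᴹ-abelianGroup renaming (∙-cancelʳ to +ᴹ-cancelʳ)

      f-matches : Matches f h X
      f-matches = f-t , hε≈

      N : Matrix
      N = proj₁ (inverse-matching h∈ X hε≈)

      t≈NXt : ∀ l → t l ≈ᴹ VF.LC (N l) Xt
      t≈NXt = proj₂ (inverse-matching h∈ X hε≈)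

      T′⊆Span-xt : T′ ⊆ Span V/F (x ++ t)
      T′⊆Span-xt = VF.independent⇒spanning F↔q {W = T′} {v = x ++ t} T′↔
        (VF.Span-++-least {x = x} {y = t} {v = B ++ t} (proj₁ x-extends) t∈T′) (proj₂ x-extends)

      Span-ABz : ∀ y → y ∈ Span V (z ++ AB)
      Span-ABz y = VK.independent⇒spanning K↔Q {W = Span V ABC} {v = z ++ AB}
        (≡.subst (λ k → HasSize (SubSetoid ≈ᴹ-setoid (Span V ABC)) (Q ^ k)) (+-comm (suc r ℕ.+ d) e)
          (VK.HasSize-Span K↔Q {v = ABC} (proj₁ ABC-basis)))
        (λ _ → proj₂ ABC-basis _) (proj₂ z-extends) (proj₂ ABC-basis y)

      f∈Span-Z : ∀ y → f y ∈ Span V Z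
      f∈Span-Z y = proj₁ (proj₂ ABC-basis y) , ≈ᴹ-refl

      -- The matrix `N` inverts `X`, so `t l` is a combination of the values `f (t i)`, which lie in
      -- the span of `Z` by construction.
      t∈Span-Z : ∀ l → t l ∈ Span V Z
      t∈Span-Z l = VK.Span-resp {v = Z} (≈ᴹ-sym (t≈NXt l))
        (VK.Span-LC (ι ∘ N l) {x = Xt} {v = Z} (λ i → VK.Span-resp {v = Z} (f-t i) (f∈Span-Z (t i))))

      T′⊆Span-Z : T′ ⊆ Span V Z
      T′⊆Span-Z y∈T′ = VK.Span-++-least {x = x} {y = t} {v = Z}
        (λ i → VK.Span-resp {v = Z} (proj₂ f-AB i) (f∈Span-Z (B i))) t∈Span-Z
        (ι ∘ proj₁ (T′⊆Span-xt y∈T′) , proj₂ (T′⊆Span-xt y∈T′))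

      -- The family `z ++ AB` spans `V`. Here `z` is part of `Z`, `A` is part of `t`, and `B` lies
      -- in T′, the F-span of `x ++ t`, where `x` is part of `Z`.
      Z-spans : ∀ y → y ∈ Span V Z
      Z-spans y = VK.Span-++-least {x = z} {y = AB} {v = Z}
        (λ i → VK.Span-resp {v = Z} (proj₂ f-ABC i) (f∈Span-Z (C i)))
        (All.++⁺ (Span V Z) {xs = A} {ys = B} (t∈Span-Z ∘ suc) (T′⊆Span-Z ∘ B∈T′))
        (Span-ABz y)

      Z-independent : LinearlyIndependent V Z
      Z-independent = VK.spanning⇒independent K↔Q {W = Span V ABC} {v = Z}
        (VK.HasSize-Span K↔Q {v = ABC} (proj₁ ABC-basis))
        (λ _ → proj₂ ABC-basis _) (λ {y} _ → Z-spans y)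

      f-preserves-T′ : ∀ {y} → y ∈ T′ → f y ∈ T′
      f-preserves-T′ (α , y≈) = VF.Span-resp {v = B ++ t}
        (≈ᴹ-sym (≈ᴹ-trans (f-cong y≈) (VK.LC-map f-homo (ι ∘ α) (B ++ t))))
        (VF.Span-LC α {x = f ∘ (B ++ t)} {v = B ++ t} (All.++⁺ (λ y → f y ∈ T′) {xs = B} {ys = t}
          (λ i → VF.Span-resp {v = B ++ t} (≈ᴹ-sym (proj₂ f-AB i)) (proj₁ x-extends i))
          (λ i → VF.Span-resp {v = B ++ t} (≈ᴹ-sym (f-t i)) (VF.Span-LC (X i) {x = t} {v = B ++ t} t∈T′))))

      f-covers-T′ : T′ ⊆ Image ≈ᴹ-setoid f T′
      f-covers-T′ {y} y∈T′ =
        VF.LC α preimage , VF.Span-LC α {x = preimage} {v = B ++ t} preimage∈T′ , (begin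
          f (VF.LC α preimage)      ≈⟨ VK.LC-map f-homo (ι ∘ α) preimage ⟩
          VF.LC α (f ∘ preimage)    ≈⟨ VF.LC-congʳ {α = α} f-preimage ⟩
          VF.LC α (x ++ t)          ≈⟨ proj₂ (T′⊆Span-xt y∈T′) ⟨
          y                         ∎)
        where
        α : Vector F.Carrier (d ℕ.+ suc (suc r))
        α = proj₁ (T′⊆Span-xt y∈T′)
        Nt : Vector Carrierᴹ (suc (suc r))
        Nt l = VF.LC (N l) t
        preimage : Vector Carrierᴹ (d ℕ.+ suc (suc r))
        -- `f` sends `B` to `x` and, as `N` inverts `X`, sends `Nt` to `t`; the target `x ++ t`
        -- spans T′.
        preimage = B ++ Nt
        preimage∈T′ : ∀ i → preimage i ∈ T′
        preimage∈T′ = All.++⁺ T′ {xs = B} {ys = Nt} B∈T′ (λ l → VF.Span-LC (N l) {x = t} {v = B ++ t} t∈T′)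
        f-preimage : ∀ i → f (preimage i) ≈ᴹ (x ++ t) i
        f-preimage = Pointwise.++⁺ (λ y w → f y ≈ᴹ w) {xs = B} {ys = x} {xs′ = Nt} {ys′ = t} (proj₂ f-AB)
          (λ l → begin
            f (Nt l)                 ≈⟨ VK.LC-map f-homo (ι ∘ N l) t ⟩
            VF.LC (N l) (f ∘ t)      ≈⟨ VF.LC-congʳ {α = N l} f-t ⟩
            VF.LC (N l) Xt           ≈⟨ t≈NXt l ⟨
            t l                      ∎)

    realisation : G.Carrier
    realisation =
      (f , VK.linearExtension-isIsomorphism {Y = ABC} (proj₁ ABC-basis) (proj₂ ABC-basis) Z Z-independent Z-spans)
      , (λ (w , w∈T′ , fw≈y) → VF.Span-resp {v = B ++ t} fw≈y (f-preserves-T′ w∈T′))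
      , f-covers-T′

    parameters-realisation : Setoid._≈_ Parameters (parameters realisation)
                               ((h , h∈) , (x , x-extends) , (z , z-extends))
    parameters-realisation =
      -- `matching` extracts a multiplier with its own matrix; agreement on `t` identifies it with
      -- the given `h`.
      multiplier-unique (multiplier-matches realisation) f-matches (λ _ → ≈ᴹ-refl) , proj₂ f-AB , proj₂ f-ABC

  G-T′↔Parameters : Inverse G-T′ Parameters
  G-T′↔Parameters = bijection⇒inverse parameters
    (λ {g} {g′} → parameters-cong {g} {g′}) (λ {g} {g′} → parameters-injective {g} {g′})
    (λ ((h , h∈) , (x , x-extends) , (z , z-extends)) →
      realisation h∈ x-extends z-extends , parameters-realisation h∈ x-extends z-extends)

  -- With `r` shifted by one, `B ++ t` has k members, `t` has `r + 2`, and `AB` has k - 1, which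
  -- fixes the exponents of both products.
  HasSize-G-T′ : ∀ {s} → HasSize Multipliers s → HasSize G-T′
    (s ℕ.* (product (map (λ j → q ^ (d ℕ.+ suc (suc r)) ∸ q ^ (suc (suc r) ℕ.+ j)) (upTo d))
      ℕ.* product (map (λ j → Q ^ (suc r ℕ.+ d ℕ.+ e) ∸ Q ^ (suc r ℕ.+ d ℕ.+ j)) (upTo e))))
  HasSize-G-T′ H↔ = HasSize-resp G-T′↔Parameters (HasSize-× H↔ (HasSize-×
    (EF.HasSize-Extensions {u = B ++ t} {v = t} Bt-independent t-independent t∈T′ d)
    (EK.HasSize-Extensions {u = ABC} {v = AB} (proj₁ ABC-basis) AB-independent AB∈Span-ABC e)))

  -- Stated up to pointwise equality because `T` picks its vectors through `inject≤`, whereas `A`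
  -- and `B` come from `take` and `drop`.
  T′≐ : {E : Vector Carrierᴹ (suc r ℕ.+ d)} {w : Carrierᴹ} → (∀ i → E i ≈ᴹ AB i) → w ≈ᴹ VK.LC u A →
        Span V/F (E ++ (w ∷ [])) ≐ T′
  T′≐ {E} {w} E≋AB w≈ =
      VF.Span-++-least {x = E} {y = w ∷ []} {v = B ++ t}
        (λ i → VF.Span-resp {v = B ++ t} (≈ᴹ-sym (E≋AB i)) (AB∈T′ i))
        (λ { zero → VF.Span-resp {v = B ++ t} (≈ᴹ-trans (-ᴹ-involutive _) (≈ᴹ-sym w≈))
                      (VF.Span--ᴹ {v = B ++ t} (t∈T′ zero)) })
    , VF.Span-++-least {x = B} {y = t} {v = Ew} B∈Ew
        (λ { zero    → VF.Span-resp {v = Ew} (-ᴹ‿cong w≈) (VF.Span--ᴹ {v = Ew} w∈Ew)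
           ; (suc i) → A∈Ew i })
    where
    open import Algebra.Module.Properties.LeftModule V using (-ᴹ-involutive)
    Ew : Vector Carrierᴹ (suc r ℕ.+ d ℕ.+ 1)
    Ew = E ++ (w ∷ [])
    AB∈T′ : ∀ i → AB i ∈ T′
    AB∈T′ = All.++⁺ T′ {xs = A} {ys = B} (t∈T′ ∘ suc) B∈T′
    AB∈Ew : ∀ i → AB i ∈ Span V/F Ew
    AB∈Ew i = VF.Span-resp {v = Ew} (E≋AB i) (VF.Span-++ˡ E (w ∷ []) (VF.Span-generator E i))
    A∈Ew : ∀ i → A i ∈ Span V/F Ew
    A∈Ew = All.++⁻ˡ (Span V/F Ew) A {ys = B} AB∈Ew
    B∈Ew : ∀ i → B i ∈ Span V/F Ew
    B∈Ew = All.++⁻ʳ (Span V/F Ew) A {ys = B} AB∈Ew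
    w∈Ew : w ∈ Span V/F Ew
    w∈Ew = VF.Span-++ʳ E (w ∷ []) (VF.Span-generator (w ∷ []) zero)

-- Transfer to the indexing of the theorem

take-++-drop : {A : Set a} (m : ℕ) (v : Vector A (m + n)) → ∀ i → (take m v ++ drop m v) i ≡ v i
take-++-drop m v = ↑-cases (λ i → (take m v ++ drop m v) i ≡ v i)
  (lookup-++ˡ (take m v) (drop m v)) (lookup-++ʳ (take m v) (drop m v))

∏-upTo : ∀ {i₀ i₁} d (f : ℕ → ℕ) {g : ℕ → ℕ} → i₀ + d ≡ i₁ → (∀ j → f (i₀ + j) ≡ g j) →
         product (map g (upTo d)) ≡ ∏[ i₀ ≤i< i₁ ] f
∏-upTo {i₀} d f refl f≗g rewrite m+n∸m≡n i₀ d =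
  cong product (map-cong (≡.sym ∘ f≗g) (upTo d))

module _ {R : Ring a ℓ₁} (V : LeftModule R b ℓ₂) where

  GL-stabilizer-cong : {W W′ : Pred (LeftModule.Carrierᴹ V) p} → W ≐ W′ →
                       Inverse (GL-stabilizer V W) (GL-stabilizer V W′)
  GL-stabilizer-cong {W = W} {W′} (W⊆W′ , W′⊆W) = bijection⇒inverse (transport W⊆W′ W′⊆W) id id
    (λ g → transport W′⊆W W⊆W′ g , λ _ → LeftModule.≈ᴹ-refl V)
    where
    transport : {W W′ : Pred (LeftModule.Carrierᴹ V) _} → W ⊆ W′ → W′ ⊆ W →
                ∃ (λ (g : GL V) → Image (LeftModule.≈ᴹ-setoid V) (proj₁ g) W ≐ W) →
                ∃ (λ (g : GL V) → Image (LeftModule.≈ᴹ-setoid V) (proj₁ g) W′ ≐ W′)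
    transport W⊆ ⊆W (g , gW⊆W , W⊆gW) = g
      , (λ (x , x∈ , eq) → W⊆ (gW⊆W (x , ⊆W x∈ , eq)))
      , (λ y∈ → let x , x∈ , eq = W⊆gW (⊆W y∈) in x , W⊆ x∈ , eq)

module StabilizerSizes
  (F : Field a ℓ₁) (K : Field c ℓ) {ι : Field.Carrier F → Field.Carrier K}
  (ι-homo : IsRingHomomorphism (Field.rawRing F) (Field.rawRing K) ι)
  {q : ℕ} (F↔q : HasSize (Field.setoid F) q) (l : ℕ) (K↔qˡ : HasSize (Field.setoid K) (q ^ l))
  (V : LeftModule (Field.ring K) b ℓ₂) (r d e : ℕ)
  (Y : Vector (LeftModule.Carrierᴹ V) (suc r + d + e)) (Y-basis : IsBasis V Y)
  (u : Vector (Field.Carrier K) (suc r))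
  (U-dimension : HasDimension (Extension.K-over-F F K ι-homo) (Extension.⟨1,_⟩ F K ι-homo u) (suc r + 1))
  where
  open Extension F K ι-homo
  open LeftModule V

  private
    module VK = LinearCombinations V
    module KF = LinearCombinations K-over-F

    E : Vector Carrierᴹ (suc r + d)
    E = take (suc r + d) Y
    A : Vector Carrierᴹ (suc r)
    A = take (suc r) E
    B : Vector Carrierᴹ d
    B = drop (suc r) E
    C : Vector Carrierᴹ e
    C = drop (suc r + d) Y

    AB≋E : ∀ i → (A ++ B) i ≈ᴹ E i
    AB≋E i = ≈ᴹ-reflexive (take-++-drop (suc r) E i)

    Y≋ABC : ∀ i → Y i ≈ᴹ ((A ++ B) ++ C) i
    Y≋ABC i = ≈ᴹ-trans (≈ᴹ-reflexive (≡.sym (take-++-drop (suc r + d) Y i)))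
      (Pointwise.++⁺ _≈ᴹ_ {xs = E} {ys = A ++ B} {xs′ = C} {ys′ = C} (λ i → ≈ᴹ-sym (AB≋E i)) (λ _ → ≈ᴹ-refl) i)

    ABC-basis : IsBasis V ((A ++ B) ++ C)
    ABC-basis = VK.LinearlyIndependent-resp {v = Y} {w = (A ++ B) ++ C} Y≋ABC (proj₁ Y-basis)
      , λ x → VK.Span-cong {v = Y} {w = (A ++ B) ++ C} Y≋ABC (proj₂ Y-basis x)

    -- The hypothesis only provides some basis of ⟨1,u⟩. It fixes the number of elements, and a
    -- spanning family of matching length is then independent by counting.
    1,u-independent : LinearlyIndependent K-over-F (Field.1# K ∷ u)
    1,u-independent = KF.spanning⇒independent F↔q {W = Span K-over-F v} {v = Field.1# K ∷ u}
      (≡.subst (λ n → HasSize (SubSetoid (Field.setoid K) (Span K-over-F v)) (q ^ n)) (+-comm (suc r) 1)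
        (KF.HasSize-Span F↔q {v = v} (proj₁ (proj₂ U-dimension))))
      (proj₁ (proj₂ (proj₂ U-dimension))) (proj₂ (proj₂ (proj₂ U-dimension)))
      where
      v : Vector (Field.Carrier K) (suc r + 1)
      v = proj₁ U-dimension

  open SubspaceStabilizer F K ι-homo V u A B C 1,u-independent ABC-basis F↔q K↔qˡ

  module _ (k≤1+m : suc (suc r + d) ≤ suc (suc r + d + e)) (r≤k-1 : suc r ≤ suc r + d) where

    T≐T′ : T V Y k≤1+m r≤k-1 u ≐ T′
    T≐T′ = T′≐
      (λ i → ≈ᴹ-trans (≈ᴹ-reflexive (cong Y (inject≤-↑ˡ i (m≤m+n (suc r + d) e)))) (≈ᴹ-sym (AB≋E i)))
      (VK.LC-congʳ {α = u} (λ i → ≈ᴹ-reflexive (cong Y (toℕ-injective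
        (≡.trans (toℕ-inject≤ i (≤-trans r≤k-1 (m≤m+n (suc r + d) e))) (≡.sym (≡.trans (toℕ-↑ˡ (i ↑ˡ d) e) (toℕ-↑ˡ i d))))))))
      where
      inject≤-↑ˡ : ∀ {m n} (i : Fin m) .(m≤m+n : m ≤ m + n) → inject≤ i m≤m+n ≡ i ↑ˡ n
      inject≤-↑ˡ {n = n} i m≤m+n = toℕ-injective (≡.trans (toℕ-inject≤ i m≤m+n) (≡.sym (toℕ-↑ˡ i n)))

    stabilizer-sizes : ∃₂ λ |G-T| |H-U| →
      HasSize (GL-stabilizer V (T V Y k≤1+m r≤k-1 u)) |G-T| ×
      HasSize (Singer-stabilizer K ⟨1, u ⟩) |H-U| ×
      |G-T| ≡ |H-U|
        * ∏[ suc r + 1 ≤i< suc (suc r + d) ] (λ i → q ^ suc (suc r + d) ∸ q ^ i)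
        * ∏[ suc r + d ≤i< suc r + d + e ] (λ i → q ^ ((suc r + d + e) * l) ∸ q ^ (i * l))
    stabilizer-sizes with s , H↔s ← HasSize-Multipliers =
      _ , s
      , HasSize-resp (GL-stabilizer-cong V T≐T′) (HasSize-G-T′ H↔s)
      , HasSize-resp Singer↔Multipliers H↔s
      , ≡.trans (≡.sym (*-assoc s _ _)) (cong₂ (λ x y → s * x * y)
          (∏-upTo d (λ i → q ^ suc (suc r + d) ∸ q ^ i) (cong (_+ d) (+-comm (suc r) 1)) λ j →
            cong₂ (λ x y → q ^ x ∸ q ^ y) (+-comm (2 + r) d) (cong (_+ j) (+-comm (suc r) 1)))
          (∏-upTo {suc r + d} e (λ i → q ^ ((suc r + d + e) * l) ∸ q ^ (i * l)) refl λ j →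
            cong₂ _∸_ (^-*-swap (suc r + d + e)) (^-*-swap (suc r + d + j))))
      where
      -- Counting over K produces powers of `Q = q ^ l`.
      ^-*-swap : ∀ n → q ^ (n * l) ≡ (q ^ l) ^ n
      ^-*-swap n = ≡.trans (cong (q ^_) (*-comm n l)) (≡.sym (^-*-assoc q l n))

lemma3p6 : ∀ {a ℓ₁ c ℓ b ℓ₂ : Level}
    (q m l k r : ℕ) → IsPrimePower q →
    3 ≤ k → (k≤1+m : k ≤ 1 + m) → k ≤ l →
    1 ≤ r → (r≤k-1 : r ≤ k ∸ 1) →
    (F : Field a ℓ₁) → HasSize (Field.setoid F) q →
    (K : Field c ℓ) → HasSize (Field.setoid K) (q ^ l) →
    (ι : Field.Carrier F → Field.Carrier K)
    (ι-homo : IsRingHomomorphism (Field.rawRing F) (Field.rawRing K) ι) →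
    (V : LeftModule (Field.ring K) b ℓ₂)
    (Y : Vector (LeftModule.Carrierᴹ V) m) → IsBasis V Y →
    (u : Vector (Field.Carrier K) r) →
    let open Extension F K ι-homo in
    HasDimension K-over-F ⟨1, u ⟩ (r + 1) →
    ∃₂ λ |G-T| |H-U| →
    HasSize (GL-stabilizer V (T V Y k≤1+m r≤k-1 u)) |G-T| ×
    HasSize (Singer-stabilizer K ⟨1, u ⟩) |H-U| ×
    |G-T| ≡ |H-U|
    * ∏[ r + 1 ≤i< k ] (λ i → q ^ k ∸ q ^ i)
    * ∏[ k ∸ 1 ≤i< m ] (λ i → q ^ (m * l) ∸ q ^ (i * l))
lemma3p6 q m l (suc n) (suc r) _ _ k≤1+m@(s≤s n≤m) _ _ r≤n F F↔q K K↔qˡ ι ι-homo V Y Y-basis u U-dimension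
  -- Writing k - 1 = r + d and m = (k - 1) + e turns the two inequalities into the splitting of `Y`
  -- into `A`, `B` and `C`.
  with d , refl ← m≤n⇒∃[o]m+o≡n r≤n
  with e , refl ← m≤n⇒∃[o]m+o≡n n≤m
  = StabilizerSizes.stabilizer-sizes F K ι-homo F↔q l K↔qˡ V r d e Y Y-basis u U-dimension k≤1+m r≤n
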